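{- Let $n\ge 2$ be an integer and let $x,y$ be complex numbers such that no denominator below vanishes, i.e. $x\notin\{ -1,\dots,-n\}$, $x-y\notin\{ -1,\dots,-n\}$, $1+x-y+ny\ne0$ and $y\notin\{ -n,-n+1,\dots,n-1\}$. Then $$\sum_{k=0}^n(-1)^k\binom{n}{k}\frac{\binom{y+k}{k}}{\binom{y-n+k}{k}}\frac{(y-1)y}{(y+k-1)(y+k)}H_{k}^{\langle3\rangle}(x)=\frac{(-1)^n(1+x-y+ny)}{2n(n-1)(1+x-y)}\,\frac{\binom{x-y+n}{n}}{\binom{x+n}{n}\binom{y}{n}}\{A_n(x,y)+B_n(x,y)\},$$ where $$A_n(x,y)=\big[H_{n}^{\langle2\rangle}(x)-H_{n}^{\langle2\rangle}(x-y)\big]+\frac{2ny}{(1+x-y)^2(1+x-y+ny)},$$ $$B_n(x,y)=\big[H_{n}(x)-H_{n}(x-y)\big]\bigg[H_{n}(x)-H_{n}(x-y)+\frac{2ny}{(1+x-y)(1+x-y+ny)}\bigg].$$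
   Context: For a complex number $u$ and an integer $k\ge 0$, $\binom{u}{k}=\frac{u(u-1)\cdots(u-k+1)}{k!}$ (equal to $1$ for $k=0$). For a complex number $u$ and a positive integer $\ell$, the generalized harmonic numbers of $\ell$-order are $H_0^{\langle\ell\rangle}(u)=0$ and $H_n^{\langle\ell\rangle}(u)=\sum_{k=1}^n\frac{1}{(u+k)^\ell}$ for $n\ge1$; $H_n(u)=H_n^{\langle1\rangle}(u)$. -}

module Defs where

open import Algebra.Apartness.Bundles using (HeytingCommutativeRing; HeytingField)
import Algebra.Apartness.Properties.HeytingCommutativeRing
open import Algebra.Apartness.Structures using (IsHeytingField)
open import Algebra.Bundles using (CommutativeRing; Semiring)
open import Algebra.Definitions using (Invertible)
import Algebra.Definitions.RawMonoid
import Algebra.Definitions.RawSemiring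
import Algebra.Properties.AbelianGroup
import Algebra.Properties.Monoid.Mult
import Algebra.Properties.Monoid.Sum
open import Algebra.Structures using (IsCommutativeRing)
open import Data.Fin.Base using (toℕ)
import Data.Fin.Properties as Fin
open import Data.Integer.Base as ℤ using (ℤ; +_; -[1+_])
import Data.Integer.Properties as ℤ
open import Data.Nat.Base as ℕ using (ℕ; zero; suc)
import Data.Nat.Properties as ℕ
open import Data.Product.Base using (∃-syntax; _,_; proj₁; proj₂) renaming (_×_ to _∧_)
open import Data.Rational.Base as ℚ using (ℚ; 0ℚ; 1ℚ; ½)
import Data.Rational.Properties as ℚ
import Data.Rational.Solver as ℚ-Solver
open import Data.Sum.Base as Sum using (_⊎_; inj₁; inj₂; [_,_]′)
open import Function.Base using (_∘_)
open import Level using (0ℓ)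
open import Relation.Binary.Definitions using (Tight; Tri; tri<; tri≈; tri>)
open import Relation.Binary.PropositionalEquality
  using (_≡_; _≢_; refl; sym; trans; cong; cong₂; subst; subst₂)
import Relation.Binary.Reasoning.Setoid
open import Relation.Binary.Structures using (IsEquivalence; IsApartnessRelation)
open import Relation.Nullary using (¬_; yes; no; contradiction)

CharacteristicZero : ∀ {c ℓ₁ ℓ₂} → HeytingField c ℓ₁ ℓ₂ → Set ℓ₂
CharacteristicZero F = ∀ n → suc n × 1# # 0#
  where
  open HeytingField F
  open Algebra.Definitions.RawMonoid
    (CommutativeRing.+-rawMonoid (HeytingCommutativeRing.commutativeRing heytingCommutativeRing))

module HeytingFieldProperties {c ℓ₁ ℓ₂} (F : HeytingField c ℓ₁ ℓ₂) where
  open HeytingField F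
  open Algebra.Apartness.Properties.HeytingCommutativeRing heytingCommutativeRing

  x#y⇒x-y#0 : ∀ {x y} → x # y → x - y # 0#
  x#y⇒x-y#0 {x} {y} x#y =
    let r , rz≈1 , _ = #⇒invertible x#y
    in invertibleˡ⇒# (r , HeytingField.trans F (*-congˡ (x-0≈x (x - y))) rz≈1)

  x-y#0⇒x#y : ∀ {x y} → x - y # 0# → x # y
  x-y#0⇒x#y {x} {y} x-y#0 =
    let r , rz≈1 , _ = #⇒invertible x-y#0
    in invertibleˡ⇒# (r , HeytingField.trans F (*-congˡ (HeytingField.sym F (x-0≈x (x - y)))) rz≈1)

module Reals where
  open import Data.Rational.Base using (_+_; _*_; _-_; -_; _<_; _≤_; ∣_∣)
  open ℚ-Solver.+-*-Solver

  Eventually : (ℕ → Set) → Set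
  Eventually P = ∃[ N ] ∀ n → N ℕ.≤ n → P n

  -- Since ∃ is Σ, a Cauchy sequence carries its modulus of convergence, so these
  -- are Bishop's real numbers.
  Cauchy : (ℕ → ℚ) → Set
  Cauchy f = ∀ ε → 0ℚ < ε → ∃[ N ] ∀ m n → N ℕ.≤ m → N ℕ.≤ n → ∣ f m - f n ∣ < ε

  -- Without no-eta-equality, conversion checking would compare real numbers
  -- componentwise and unfold the Cauchy proofs.
  record ℝ : Set where
    no-eta-equality
    constructor mkℝ
    field
      seq    : ℕ → ℚ
      cauchy : Cauchy seq
  open ℝ public

  infix 4 _≈_ _#_

  record _≈_ (x y : ℝ) : Set where
    constructor mk≈
    field
      close : ∀ ε → 0ℚ < ε → Eventually λ n → ∣ seq x n - seq y n ∣ < ε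
  open _≈_ public

  -- Apartness, the positive form of x ≠ y: it is the condition under which x - y
  -- has an inverse, and classically it is equivalent to ¬ (x ≈ y).
  record _#_ (x y : ℝ) : Set where
    constructor mk#
    field
      gap      : ℚ
      0<gap    : 0ℚ < gap
      separate : Eventually λ n → gap < ∣ seq x n - seq y n ∣
  open _#_ public

  private
    ev-map : ∀ {P Q : ℕ → Set} → (∀ n → P n → Q n) → Eventually P → Eventually Q
    ev-map f (N , p) = N , λ n N≤n → f n (p n N≤n)

    ev-map₂ : ∀ {P Q R : ℕ → Set} → (∀ n → P n → Q n → R n) →
              Eventually P → Eventually Q → Eventually R
    ev-map₂ f (N , p) (M , q) = N ℕ.⊔ M , λ n h →
      f n (p n (ℕ.≤-trans (ℕ.m≤m⊔n N M) h)) (q n (ℕ.≤-trans (ℕ.m≤n⊔m N M) h))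

    always : ∀ {P : ℕ → Set} → (∀ n → P n) → Eventually P
    always p = 0 , λ n _ → p n

    ev-absurd : ∀ {P : ℕ → Set} → Eventually P → ¬ Eventually (λ n → ¬ P n)
    ev-absurd (N , p) (M , q) =
      q (N ℕ.⊔ M) (ℕ.m≤n⊔m N M) (p (N ℕ.⊔ M) (ℕ.m≤m⊔n N M))

    half+half : ∀ p → ½ * p + ½ * p ≡ p
    half+half = solve 1 (λ p → con ½ :* p :+ con ½ :* p := p) refl

    pos* : ∀ {p q} → 0ℚ < p → 0ℚ < q → 0ℚ < p * q
    pos* {p} {q} 0<p 0<q = subst (_< p * q) (ℚ.*-zeroʳ p)
      (ℚ.*-monoʳ-<-pos p {{ℚ.positive 0<p}} 0<q)

    0<½* : ∀ {p} → 0ℚ < p → 0ℚ < ½ * p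
    0<½* = pos* (ℚ.positive⁻¹ ½)

    ∣-∣-sym : ∀ p q → ∣ p - q ∣ ≡ ∣ q - p ∣
    ∣-∣-sym p q = trans (sym (ℚ.∣-p∣≡∣p∣ (p - q)))
      (cong ∣_∣ (solve 2 (λ p q → :- (p :- q) := q :- p) refl p q))

    triangle : ∀ p q r → ∣ p - r ∣ ≤ ∣ p - q ∣ + ∣ q - r ∣
    triangle p q r = subst (λ s → ∣ s ∣ ≤ ∣ p - q ∣ + ∣ q - r ∣)
      (solve 3 (λ p q r → (p :- q) :+ (q :- r) := p :- r) refl p q r)
      (ℚ.∣p+q∣≤∣p∣+∣q∣ (p - q) (q - r))

    diff-self : ∀ {p q} → p ≡ q → ∣ p - q ∣ ≡ 0ℚ
    diff-self {p} refl = cong ∣_∣ (ℚ.+-inverseʳ p)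

    p≤∣p∣ : ∀ p → p ≤ ∣ p ∣
    p≤∣p∣ p with ℚ.≤-total 0ℚ p
    ... | inj₁ 0≤p = ℚ.≤-reflexive (sym (ℚ.0≤p⇒∣p∣≡p 0≤p))
    ... | inj₂ p≤0 = ℚ.≤-trans p≤0 (ℚ.0≤∣p∣ p)

    mono* : ∀ {a b c} → 0ℚ ≤ c → a ≤ b → a * c ≤ b * c
    mono* {c = c} 0≤c = ℚ.*-monoʳ-≤-nonNeg c {{ℚ.nonNegative 0≤c}}

    mono*ˡ : ∀ {a b c} → 0ℚ ≤ c → a ≤ b → c * a ≤ c * b
    mono*ˡ {c = c} 0≤c = ℚ.*-monoˡ-≤-nonNeg c {{ℚ.nonNegative 0≤c}}

    mono*< : ∀ {a b c} → 0ℚ < c → a < b → a * c < b * c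
    mono*< {c = c} 0<c = ℚ.*-monoˡ-<-pos c {{ℚ.positive 0<c}}

    cancel+ : ∀ {a b} c → a + c < b + c → a < b
    cancel+ {a} {b} c h = subst₂ _<_ (eq a) (eq b) (ℚ.+-monoˡ-< (- c) h)
      where
      eq : ∀ a → a + c + - c ≡ a
      eq a = solve 2 (λ a c → a :+ c :+ :- c := a) refl a c

  -- Total reciprocal on ℚ (junk value 0 at 0), so that a sequence that is only
  -- eventually nonzero can be inverted termwise.
  recip : ℚ → ℚ
  recip p with p ℚ.≟ 0ℚ
  ... | yes _   = 0ℚ
  ... | no  p≢0 = ℚ.1/_ p {{ℚ.≢-nonZero p≢0}}

  private
    recip-inverse : ∀ p → p ≢ 0ℚ → recip p * p ≡ 1ℚ
    recip-inverse p p≢0 with p ℚ.≟ 0ℚ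
    ... | yes p≡0 = contradiction p≡0 p≢0
    ... | no  p≢0 = ℚ.*-inverseˡ p {{ℚ.≢-nonZero p≢0}}

    pos≢0 : ∀ {p} → 0ℚ < p → p ≢ 0ℚ
    pos≢0 0<p p≡0 = ℚ.<⇒≢ 0<p (sym p≡0)

    abs≢0 : ∀ {p} → 0ℚ < ∣ p ∣ → p ≢ 0ℚ
    abs≢0 0<∣p∣ refl = ℚ.<-irrefl refl 0<∣p∣

    0<recip : ∀ {p} → 0ℚ < p → 0ℚ < recip p
    0<recip {p} 0<p = ℚ.*-cancelʳ-<-nonNeg p {{ℚ.nonNegative (ℚ.<⇒≤ 0<p)}}
      (subst₂ _<_ (sym (ℚ.*-zeroˡ p)) (sym (recip-inverse p (pos≢0 0<p))) (ℚ.positive⁻¹ 1ℚ))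

    Close : (f g : ℕ → ℚ) → Set
    Close f g = ∀ ε → 0ℚ < ε → ∃[ N ] ∀ m n → N ℕ.≤ m → N ℕ.≤ n → ∣ f m - g n ∣ < ε

    toClose : ∀ {x y} → x ≈ y → Close (seq x) (seq y)
    toClose {x} {y} x≈y ε 0<ε =
      let N , p = cauchy x (½ * ε) (0<½* 0<ε)
          M , q = close x≈y (½ * ε) (0<½* 0<ε)
      in N ℕ.⊔ M , λ m n h k → subst (∣ seq x m - seq y n ∣ <_) (half+half ε)
           (ℚ.≤-<-trans (triangle (seq x m) (seq x n) (seq y n))
             (ℚ.+-mono-< (p m n (ℕ.≤-trans (ℕ.m≤m⊔n N M) h) (ℕ.≤-trans (ℕ.m≤m⊔n N M) k))
                         (q n (ℕ.≤-trans (ℕ.m≤n⊔m N M) k))))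

    fromClose : ∀ {x y} → Close (seq x) (seq y) → x ≈ y
    fromClose c = mk≈ λ ε 0<ε → let N , p = c ε 0<ε in N , λ n h → p n n h h

    Bounded : (ℕ → ℚ) → Set
    Bounded f = ∃[ B ] 0ℚ < B ∧ Eventually λ n → ∣ f n ∣ < B

    bounded : ∀ f → Cauchy f → Bounded f
    bounded f c =
      let N , p = c 1ℚ (ℚ.positive⁻¹ 1ℚ)
          bound : ∀ n → N ℕ.≤ n → ∣ f n ∣ < 1ℚ + ∣ f N ∣
          bound n N≤n = ℚ.≤-<-trans
            (subst (λ s → ∣ s ∣ ≤ ∣ f n - f N ∣ + ∣ f N ∣)
              (solve 2 (λ a b → (a :- b) :+ b := a) refl (f n) (f N))
              (ℚ.∣p+q∣≤∣p∣+∣q∣ (f n - f N) (f N)))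
            (ℚ.+-monoˡ-< ∣ f N ∣ (p n N N≤n ℕ.≤-refl))
      in 1ℚ + ∣ f N ∣ , ℚ.≤-<-trans (ℚ.0≤∣p∣ (f N)) (bound N ℕ.≤-refl) , N , bound

    +-close : ∀ {f f′ g g′} → Close f f′ → Close g g′ →
              Close (λ n → f n + g n) (λ n → f′ n + g′ n)
    +-close {f} {f′} {g} {g′} cf cg ε 0<ε =
      let N , p = cf (½ * ε) (0<½* 0<ε)
          M , q = cg (½ * ε) (0<½* 0<ε)
      in N ℕ.⊔ M , λ m n h k → subst₂ (λ s t → ∣ s ∣ < t)
           (solve 4 (λ a b c d → (a :- c) :+ (b :- d) := (a :+ b) :- (c :+ d)) refl
             (f m) (g m) (f′ n) (g′ n))
           (half+half ε)
           (ℚ.≤-<-trans (ℚ.∣p+q∣≤∣p∣+∣q∣ (f m - f′ n) (g m - g′ n))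
             (ℚ.+-mono-<
               (p m n (ℕ.≤-trans (ℕ.m≤m⊔n N M) h) (ℕ.≤-trans (ℕ.m≤m⊔n N M) k))
               (q m n (ℕ.≤-trans (ℕ.m≤n⊔m N M) h) (ℕ.≤-trans (ℕ.m≤n⊔m N M) k))))

    neg-close : ∀ {f f′} → Close f f′ → Close (λ n → - f n) (λ n → - f′ n)
    neg-close {f} {f′} cf ε 0<ε =
      let N , p = cf ε 0<ε
      in N , λ m n h k → subst (_< ε)
           (trans (sym (ℚ.∣-p∣≡∣p∣ (f m - f′ n)))
             (cong ∣_∣ (solve 2 (λ a b → :- (a :- b) := :- a :- :- b) refl (f m) (f′ n))))
           (p m n h k)

    *-close : ∀ {f f′ g g′} → Bounded f → Bounded g′ → Close f f′ → Close g g′ →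
              Close (λ n → f n * g n) (λ n → f′ n * g′ n)
    *-close {f} {f′} {g} {g′} (B , 0<B , N₁ , b) (C , 0<C , N₂ , c) cf cg ε 0<ε =
      let 0<B+C = ℚ.+-mono-< 0<B 0<C
          δ = ε * recip (B + C)
          0<δ = pos* 0<ε (0<recip 0<B+C)
          N₃ , p = cf δ 0<δ
          N₄ , q = cg δ 0<δ
          N = (N₁ ℕ.⊔ N₂) ℕ.⊔ (N₃ ℕ.⊔ N₄)
          l₁ = ℕ.≤-trans (ℕ.m≤m⊔n N₁ N₂) (ℕ.m≤m⊔n (N₁ ℕ.⊔ N₂) (N₃ ℕ.⊔ N₄))
          l₂ = ℕ.≤-trans (ℕ.m≤n⊔m N₁ N₂) (ℕ.m≤m⊔n (N₁ ℕ.⊔ N₂) (N₃ ℕ.⊔ N₄))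
          l₃ = ℕ.≤-trans (ℕ.m≤m⊔n N₃ N₄) (ℕ.m≤n⊔m (N₁ ℕ.⊔ N₂) (N₃ ℕ.⊔ N₄))
          l₄ = ℕ.≤-trans (ℕ.m≤n⊔m N₃ N₄) (ℕ.m≤n⊔m (N₁ ℕ.⊔ N₂) (N₃ ℕ.⊔ N₄))
      in N , λ m n h k →
        let fg = ℚ.≤-<-trans
              (mono*ˡ (ℚ.0≤∣p∣ (f m)) (ℚ.<⇒≤ (q m n (ℕ.≤-trans l₄ h) (ℕ.≤-trans l₄ k))))
              (mono*< 0<δ (b m (ℕ.≤-trans l₁ h)))
            gf = ℚ.≤-<-trans
              (mono* (ℚ.0≤∣p∣ (g′ n)) (ℚ.<⇒≤ (p m n (ℕ.≤-trans l₃ h) (ℕ.≤-trans l₃ k))))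
              (ℚ.*-monoʳ-<-pos δ {{ℚ.positive 0<δ}} (c n (ℕ.≤-trans l₂ k)))
        in subst₂ (λ s t → ∣ s ∣ < t)
          (solve 4 (λ a b c d → a :* (b :- d) :+ (a :- c) :* d := a :* b :- c :* d) refl
            (f m) (g m) (f′ n) (g′ n))
          (trans
            (solve 4 (λ e r b c → b :* (e :* r) :+ (e :* r) :* c := e :* (r :* (b :+ c))) refl
              ε (recip (B + C)) B C)
            (trans (cong (ε *_) (recip-inverse (B + C) (pos≢0 0<B+C))) (ℚ.*-identityʳ ε)))
          (ℚ.≤-<-trans (ℚ.∣p+q∣≤∣p∣+∣q∣ (f m * (g m - g′ n)) ((f m - f′ n) * g′ n))
            (ℚ.+-mono-<
              (subst (_< B * δ) (sym (ℚ.∣p*q∣≡∣p∣*∣q∣ (f m) (g m - g′ n))) fg)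
              (subst (_< δ * C) (sym (ℚ.∣p*q∣≡∣p∣*∣q∣ (f m - f′ n) (g′ n))) gf)))

    recip-cauchy : ∀ {f} η → 0ℚ < η → Eventually (λ n → η < ∣ f n ∣) →
                   Cauchy f → Cauchy (recip ∘ f)
    recip-cauchy {f} η 0<η (M , away) cf ε 0<ε =
      let 0<εηη = pos* (pos* 0<ε 0<η) 0<η
          N , p = cf (ε * η * η) 0<εηη
      in N ℕ.⊔ M , λ m n h k →
        let a = f m ; b = f n
            ηa = away m (ℕ.≤-trans (ℕ.m≤n⊔m N M) h)
            ηb = away n (ℕ.≤-trans (ℕ.m≤n⊔m N M) k)
            d  = recip a - recip b
            0≤d = ℚ.0≤∣p∣ d
            0≤η = ℚ.<⇒≤ 0<η
            ra = recip-inverse a (abs≢0 (ℚ.<-trans 0<η ηa))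
            rb = recip-inverse b (abs≢0 (ℚ.<-trans 0<η ηb))
            key : ∣ d ∣ * ∣ a ∣ * ∣ b ∣ ≡ ∣ b - a ∣
            key = trans (cong (_* ∣ b ∣) (sym (ℚ.∣p*q∣≡∣p∣*∣q∣ d a)))
              (trans (sym (ℚ.∣p*q∣≡∣p∣*∣q∣ (d * a) b))
              (cong ∣_∣
                (trans (solve 4 (λ r s a b → (r :- s) :* a :* b := (r :* a) :* b :- (s :* b) :* a)
                         refl (recip a) (recip b) a b)
                (cong₂ _-_ (trans (cong (_* b) ra) (ℚ.*-identityˡ b))
                           (trans (cong (_* a) rb) (ℚ.*-identityˡ a))))))
            step : ∣ d ∣ * η * η ≤ ∣ b - a ∣
            step = subst (∣ d ∣ * η * η ≤_) key
              (ℚ.≤-trans (mono* 0≤η (mono*ˡ 0≤d (ℚ.<⇒≤ ηa)))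
                (mono*ˡ
                  (subst (0ℚ ≤_) (ℚ.∣p*q∣≡∣p∣*∣q∣ d a) (ℚ.0≤∣p∣ (d * a)))
                  (ℚ.<⇒≤ ηb)))
            cancel : ∀ {p q} → p * η < q * η → p < q
            cancel = ℚ.*-cancelʳ-<-nonNeg η {{ℚ.nonNegative 0≤η}}
        in cancel (cancel (ℚ.≤-<-trans step
             (p n m (ℕ.≤-trans (ℕ.m≤m⊔n N M) k) (ℕ.≤-trans (ℕ.m≤m⊔n N M) h))))

  infixl 6 _+ᴿ_
  infixl 7 _*ᴿ_
  infix  8 -ᴿ_

  _+ᴿ_ : ℝ → ℝ → ℝ
  seq    (x +ᴿ y) n = seq x n + seq y n
  cauchy (x +ᴿ y)   = +-close {seq x} {seq x} {seq y} {seq y} (cauchy x) (cauchy y)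

  _*ᴿ_ : ℝ → ℝ → ℝ
  seq    (x *ᴿ y) n = seq x n * seq y n
  cauchy (x *ᴿ y)   = *-close {seq x} {seq x} {seq y} {seq y}
    (bounded (seq x) (cauchy x)) (bounded (seq y) (cauchy y)) (cauchy x) (cauchy y)

  -ᴿ_ : ℝ → ℝ
  seq    (-ᴿ x) n = - seq x n
  cauchy (-ᴿ x)   = neg-close {seq x} {seq x} (cauchy x)

  fromℚ : ℚ → ℝ
  seq    (fromℚ q) _     = q
  cauchy (fromℚ q) ε 0<ε = 0 , λ _ _ _ _ → subst (_< ε) (sym (diff-self {q} refl)) 0<ε

  0ᴿ 1ᴿ : ℝ
  0ᴿ = fromℚ 0ℚ
  1ᴿ = fromℚ 1ℚ

  ev-≡⇒≈ : ∀ {x y} → Eventually (λ n → seq x n ≡ seq y n) → x ≈ y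
  ev-≡⇒≈ e = mk≈ λ ε 0<ε → ev-map (λ n eq → subst (_< ε) (sym (diff-self eq)) 0<ε) e

  ≗⇒≈ : ∀ {x y} → (∀ n → seq x n ≡ seq y n) → x ≈ y
  ≗⇒≈ e = ev-≡⇒≈ (always e)

  private
    ≈-isEquivalence : IsEquivalence _≈_
    ≈-isEquivalence = record
      { refl  = ≗⇒≈ λ _ → refl
      ; sym   = λ {x} {y} x≈y → mk≈ λ ε 0<ε →
          ev-map (λ n → subst (_< ε) (∣-∣-sym (seq x n) (seq y n))) (close x≈y ε 0<ε)
      ; trans = λ {x} {y} {z} x≈y y≈z → mk≈ λ ε 0<ε →
          ev-map₂ (λ n p q → subst (∣ seq x n - seq z n ∣ <_) (half+half ε)
              (ℚ.≤-<-trans (triangle (seq x n) (seq y n) (seq z n)) (ℚ.+-mono-< p q)))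
            (close x≈y (½ * ε) (0<½* 0<ε)) (close y≈z (½ * ε) (0<½* 0<ε))
      }

  isCommutativeRing : IsCommutativeRing _≈_ _+ᴿ_ _*ᴿ_ -ᴿ_ 0ᴿ 1ᴿ
  isCommutativeRing = record
    { isRing = record
      { +-isAbelianGroup = record
        { isGroup = record
          { isMonoid = record
            { isSemigroup = record
              { isMagma = record
                { isEquivalence = ≈-isEquivalence
                ; ∙-cong = λ {x} {y} {u} {v} p q → fromClose
                    (+-close {seq x} {seq y} {seq u} {seq v} (toClose p) (toClose q))
                }
              ; assoc = λ x y z → ≗⇒≈ λ n → ℚ.+-assoc (seq x n) (seq y n) (seq z n)
              }
            ; identity = (λ x → ≗⇒≈ λ n → ℚ.+-identityˡ (seq x n))
                       , (λ x → ≗⇒≈ λ n → ℚ.+-identityʳ (seq x n))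
            }
          ; inverse = (λ x → ≗⇒≈ λ n → ℚ.+-inverseˡ (seq x n))
                    , (λ x → ≗⇒≈ λ n → ℚ.+-inverseʳ (seq x n))
          ; ⁻¹-cong = λ {x} {y} p → fromClose (neg-close {seq x} {seq y} (toClose p))
          }
        ; comm = λ x y → ≗⇒≈ λ n → ℚ.+-comm (seq x n) (seq y n)
        }
      ; *-cong = λ {x} {y} {u} {v} p q → fromClose
          (*-close {seq x} {seq y} {seq u} {seq v}
            (bounded (seq x) (cauchy x)) (bounded (seq v) (cauchy v)) (toClose p) (toClose q))
      ; *-assoc = λ x y z → ≗⇒≈ λ n → ℚ.*-assoc (seq x n) (seq y n) (seq z n)
      ; *-identity = (λ x → ≗⇒≈ λ n → ℚ.*-identityˡ (seq x n))
                   , (λ x → ≗⇒≈ λ n → ℚ.*-identityʳ (seq x n))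
      ; distrib = (λ x y z → ≗⇒≈ λ n → ℚ.*-distribˡ-+ (seq x n) (seq y n) (seq z n))
                , (λ x y z → ≗⇒≈ λ n → ℚ.*-distribʳ-+ (seq x n) (seq y n) (seq z n))
      }
    ; *-comm = λ x y → ≗⇒≈ λ n → ℚ.*-comm (seq x n) (seq y n)
    }

  private
    ∣p∣≤∣q∣+∣p-q∣ : ∀ p q → ∣ p ∣ ≤ ∣ q ∣ + ∣ p - q ∣
    ∣p∣≤∣q∣+∣p-q∣ p q = subst (λ s → ∣ s ∣ ≤ ∣ q ∣ + ∣ p - q ∣)
      (solve 2 (λ p q → q :+ (p :- q) := p) refl p q) (ℚ.∣p+q∣≤∣p∣+∣q∣ q (p - q))

    ½p<p : ∀ {p} → 0ℚ < p → ½ * p < p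
    ½p<p {p} 0<p = subst₂ _<_ (ℚ.+-identityʳ (½ * p)) (half+half p)
      (ℚ.+-monoʳ-< (½ * p) (0<½* 0<p))

    dichotomy : ∀ x y ε → 0ℚ < ε →
                x # y ⊎ Eventually λ n → ∣ seq x n - seq y n ∣ < ε
    dichotomy x y ε 0<ε = decide (ℚ.<-cmp ∣ z N ∣ h)
      where
      z = λ n → seq x n - seq y n
      h = ½ * ε
      q = ½ * h
      0<q : 0ℚ < q
      0<q = 0<½* (0<½* 0<ε)
      N = proj₁ (cauchy (x +ᴿ -ᴿ y) q 0<q)
      near : ∀ m n → N ℕ.≤ m → N ℕ.≤ n → ∣ z m - z n ∣ < q
      near = proj₂ (cauchy (x +ᴿ -ᴿ y) q 0<q)

      small : ∣ z N ∣ < h → ∀ n → N ℕ.≤ n → ∣ z n ∣ < ε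
      small zN<h n N≤n = subst (∣ z n ∣ <_) (half+half ε)
        (ℚ.≤-<-trans (∣p∣≤∣q∣+∣p-q∣ (z n) (z N))
          (ℚ.+-mono-< zN<h (ℚ.<-trans (near n N N≤n ℕ.≤-refl) (½p<p (0<½* 0<ε)))))

      large : h ≤ ∣ z N ∣ → ∀ n → N ℕ.≤ n → q < ∣ z n ∣
      large h≤zN n N≤n = cancel+ q (subst (_< ∣ z n ∣ + q) (sym (half+half h))
        (ℚ.≤-<-trans h≤zN
          (ℚ.≤-<-trans (∣p∣≤∣q∣+∣p-q∣ (z N) (z n))
            (ℚ.+-monoʳ-< ∣ z n ∣ (near N n ℕ.≤-refl N≤n)))))

      decide : Tri (∣ z N ∣ < h) (∣ z N ∣ ≡ h) (h < ∣ z N ∣) →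
               x # y ⊎ Eventually λ n → ∣ z n ∣ < ε
      decide (tri< lt _ _) = inj₂ (N , small lt)
      decide (tri≈ _ eq _) = inj₁ (mk# q 0<q (N , large (ℚ.≤-reflexive (sym eq))))
      decide (tri> _ _ gt) = inj₁ (mk# q 0<q (N , large (ℚ.<⇒≤ gt)))

    #-irrefl : ∀ {x y} → x ≈ y → ¬ x # y
    #-irrefl x≈y (mk# η 0<η far) =
      ev-absurd far (ev-map (λ n p q → ℚ.<-asym p q) (close x≈y η 0<η))

    #-isApartness : IsApartnessRelation _≈_ _#_
    #-isApartness = record
      { irrefl  = #-irrefl
      ; sym     = λ {x} {y} (mk# η 0<η far) →
          mk# η 0<η (ev-map (λ n → subst (η <_) (∣-∣-sym (seq x n) (seq y n))) far)
      ; cotrans = λ {x} {y} (mk# η 0<η far) z →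
          [ inj₁
          , (λ near → inj₂ (mk# (½ * η) (0<½* 0<η) (ev-map₂ (λ n η<xy xz<½η →
              cancel+ (½ * η) (subst (_< ∣ seq z n - seq y n ∣ + ½ * η) (sym (half+half η))
                (ℚ.<-trans η<xy (ℚ.≤-<-trans
                  (subst (∣ seq x n - seq y n ∣ ≤_)
                    (ℚ.+-comm ∣ seq x n - seq z n ∣ ∣ seq z n - seq y n ∣)
                    (triangle (seq x n) (seq z n) (seq y n)))
                  (ℚ.+-monoʳ-< ∣ seq z n - seq y n ∣ xz<½η)))))
              far near)))
          ]′ (dichotomy x z (½ * η) (0<½* 0<η))
      }

    #⇒inv : ∀ {x y} → x # y → Invertible _≈_ 1ᴿ _*ᴿ_ (x +ᴿ -ᴿ y)
    #⇒inv {x} {y} (mk# η 0<η far) = x-y⁻¹ , ev-≡⇒≈ left , ev-≡⇒≈ (ev-map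
        (λ n → trans (ℚ.*-comm (seq x n - seq y n) (recip (seq x n - seq y n)))) left)
      where
      x-y⁻¹ : ℝ
      seq    x-y⁻¹ n = recip (seq x n - seq y n)
      cauchy x-y⁻¹   = recip-cauchy η 0<η far (cauchy (x +ᴿ -ᴿ y))
      left : Eventually λ n → recip (seq x n - seq y n) * (seq x n - seq y n) ≡ 1ℚ
      left = ev-map (λ n h → recip-inverse (seq x n - seq y n) (abs≢0 (ℚ.<-trans 0<η h))) far

    away-from-0 : ∀ {B h w z} → 0ℚ < B → h + h ≡ 1ℚ → ∣ w ∣ < B → ∣ w * z - 1ℚ ∣ < h →
                  recip B * h < ∣ z ∣
    away-from-0 {B} {h} {w} {z} 0<B h+h≡1 w<B near =
      ℚ.*-cancelʳ-<-nonNeg B {{ℚ.nonNegative (ℚ.<⇒≤ 0<B)}}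
        (subst₂ _<_ (sym lhs) (ℚ.*-comm B ∣ z ∣) (ℚ.<-≤-trans h<wz wz≤Bz))
      where
      lhs : recip B * h * B ≡ h
      lhs = trans (solve 3 (λ r h b → r :* h :* b := h :* (r :* b)) refl (recip B) h B)
        (trans (cong (h *_) (recip-inverse B (pos≢0 0<B))) (ℚ.*-identityʳ h))
      h<wz : h < ∣ w * z ∣
      h<wz = cancel+ h (subst (_< ∣ w * z ∣ + h) (sym h+h≡1)
        (ℚ.≤-<-trans (∣p∣≤∣q∣+∣p-q∣ 1ℚ (w * z))
          (ℚ.+-monoʳ-< ∣ w * z ∣ (subst (_< h) (∣-∣-sym (w * z) 1ℚ) near))))
      wz≤Bz : ∣ w * z ∣ ≤ B * ∣ z ∣
      wz≤Bz = subst (_≤ B * ∣ z ∣) (sym (ℚ.∣p*q∣≡∣p∣*∣q∣ w z))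
        (mono* (ℚ.0≤∣p∣ z) (ℚ.<⇒≤ w<B))

    inv⇒# : ∀ {x y} → Invertible _≈_ 1ᴿ _*ᴿ_ (x +ᴿ -ᴿ y) → x # y
    inv⇒# {x} {y} (w , w*z≈1 , _) = mk# (recip B * ½) (pos* (0<recip 0<B) (ℚ.positive⁻¹ ½))
      (ev-map₂ (λ n → away-from-0 {B} {½} {seq w n} {seq x n - seq y n} 0<B refl)
        w<B (close w*z≈1 ½ (ℚ.positive⁻¹ ½)))
      where
      B = proj₁ (bounded (seq w) (cauchy w))
      0<B = proj₁ (proj₂ (bounded (seq w) (cauchy w)))
      w<B = proj₂ (proj₂ (bounded (seq w) (cauchy w)))

  private
    #-tight : Tight _≈_ _#_
    #-tight x y = to , #-irrefl
      where
      to : ¬ x # y → x ≈ y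
      to ¬x#y = mk≈ λ ε 0<ε →
        [ (λ x#y → contradiction x#y ¬x#y) , (λ near → near) ]′ (dichotomy x y ε 0<ε)

  isHeytingField : IsHeytingField _≈_ _#_ _+ᴿ_ _*ᴿ_ -ᴿ_ 0ᴿ 1ᴿ
  isHeytingField = record
    { isHeytingCommutativeRing = record
      { isCommutativeRing   = isCommutativeRing
      ; isApartnessRelation = #-isApartness
      ; #⇒invertible        = #⇒inv
      ; invertible⇒#        = inv⇒#
      }
    ; tight = #-tight
    }

  ℝ-heytingField : HeytingField 0ℓ 0ℓ 0ℓ
  ℝ-heytingField = record { isHeytingField = isHeytingField }

  private
    square≥0 : ∀ p → 0ℚ ≤ p * p
    square≥0 p with ℚ.≤-total 0ℚ p
    ... | inj₁ 0≤p = subst (_≤ p * p) (ℚ.*-zeroˡ p) (mono* 0≤p 0≤p)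
    ... | inj₂ p≤0 = subst (0ℚ ≤_) (solve 1 (λ p → :- p :* :- p := p :* p) refl p)
            (subst (_≤ - p * - p) (ℚ.*-zeroˡ (- p)) (mono* 0≤-p 0≤-p))
      where
      0≤-p = ℚ.neg-antimono-≤ p≤0

    η<∣p∣⇒ηη<pp : ∀ {η} p → 0ℚ < η → η < ∣ p - 0ℚ ∣ → η * η < p * p
    η<∣p∣⇒ηη<pp {η} p 0<η η<∣p∣′ = ℚ.<-≤-trans
      (ℚ.<-trans (mono*< 0<η η<∣p∣) (ℚ.*-monoʳ-<-pos ∣ p ∣ {{ℚ.positive (ℚ.<-trans 0<η η<∣p∣)}} η<∣p∣))
      (ℚ.≤-reflexive (trans (sym (ℚ.∣p*q∣≡∣p∣*∣q∣ p p)) (ℚ.0≤p⇒∣p∣≡p (square≥0 p))))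
      where
      η<∣p∣ = subst (λ s → η < ∣ s ∣) (ℚ.+-identityʳ p) η<∣p∣′

  a²+b²#0 : ∀ {a b} → a # 0ᴿ ⊎ b # 0ᴿ → a *ᴿ a +ᴿ b *ᴿ b # 0ᴿ
  a²+b²#0 {a} {b} (inj₁ (mk# η 0<η far)) = mk# (η * η) (pos* 0<η 0<η)
    (ev-map (λ n h → let p = seq a n ; q = seq b n in
      subst (λ s → η * η < ∣ s ∣) (sym (ℚ.+-identityʳ (p * p + q * q)))
        (ℚ.<-≤-trans
          (subst (_< p * p + q * q) (ℚ.+-identityʳ (η * η))
            (ℚ.+-mono-<-≤ (η<∣p∣⇒ηη<pp p 0<η h) (square≥0 q)))
          (p≤∣p∣ (p * p + q * q)))) far)
  a²+b²#0 {a} {b} (inj₂ (mk# η 0<η far)) = mk# (η * η) (pos* 0<η 0<η)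
    (ev-map (λ n h → let p = seq a n ; q = seq b n in
      subst (λ s → η * η < ∣ s ∣) (sym (ℚ.+-identityʳ (p * p + q * q)))
        (ℚ.<-≤-trans
          (subst (_< p * p + q * q) (ℚ.+-identityˡ (η * η))
            (ℚ.+-mono-≤-< (square≥0 p) (η<∣p∣⇒ηη<pp q 0<η h)))
          (p≤∣p∣ (p * p + q * q)))) far)

  1≤⇒#0 : ∀ {x} → (∀ n → 1ℚ ≤ seq x n) → x # 0ᴿ
  1≤⇒#0 {x} 1≤x = mk# ½ (ℚ.positive⁻¹ ½) (always λ n →
    subst (λ s → ½ < ∣ s ∣) (sym (ℚ.+-identityʳ (seq x n)))
      (ℚ.<-≤-trans (½p<p (ℚ.positive⁻¹ 1ℚ)) (ℚ.≤-trans (1≤x n) (p≤∣p∣ (seq x n)))))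

module Complexes where
  open Reals using (ℝ; seq; 0ᴿ; 1ᴿ; _+ᴿ_; _*ᴿ_; -ᴿ_; ≗⇒≈; a²+b²#0; 1≤⇒#0; ℝ-heytingField)
  open HeytingFieldProperties ℝ-heytingField
  open ℚ-Solver.+-*-Solver

  private
    module R = HeytingField ℝ-heytingField
    module RP = Algebra.Apartness.Properties.HeytingCommutativeRing R.heytingCommutativeRing

  record ℂ : Set where
    no-eta-equality
    constructor _+i_
    field
      re im : ℝ
  open ℂ public

  infix 4 _≈_ _#_

  record _≈_ (z w : ℂ) : Set where
    constructor mk≈
    field
      re≈ : re z R.≈ re w
      im≈ : im z R.≈ im w
  open _≈_

  data _#_ (z w : ℂ) : Set where
    re# : re z R.# re w → z # w
    im# : im z R.# im w → z # w

  infixl 6 _+ᶜ_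
  infixl 7 _*ᶜ_
  infix  8 -ᶜ_

  _+ᶜ_ : ℂ → ℂ → ℂ
  re (z +ᶜ w) = re z +ᴿ re w
  im (z +ᶜ w) = im z +ᴿ im w

  _*ᶜ_ : ℂ → ℂ → ℂ
  re (z *ᶜ w) = re z *ᴿ re w +ᴿ -ᴿ (im z *ᴿ im w)
  im (z *ᶜ w) = re z *ᴿ im w +ᴿ im z *ᴿ re w

  -ᶜ_ : ℂ → ℂ
  re (-ᶜ z) = -ᴿ re z
  im (-ᶜ z) = -ᴿ im z

  0ᶜ 1ᶜ : ℂ
  re 0ᶜ = 0ᴿ
  im 0ᶜ = 0ᴿ
  re 1ᶜ = 1ᴿ
  im 1ᶜ = 0ᴿ

  private
    ≈-isEquivalence : IsEquivalence _≈_
    ≈-isEquivalence = record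
      { refl  = mk≈ R.refl R.refl
      ; sym   = λ (mk≈ p q) → mk≈ (R.sym p) (R.sym q)
      ; trans = λ (mk≈ p q) (mk≈ r s) → mk≈ (R.trans p r) (R.trans q s)
      }

    *-assoc-re : ∀ a b c d e f →
      (a ℚ.* c ℚ.- b ℚ.* d) ℚ.* e ℚ.- (a ℚ.* d ℚ.+ b ℚ.* c) ℚ.* f ≡
      a ℚ.* (c ℚ.* e ℚ.- d ℚ.* f) ℚ.- b ℚ.* (c ℚ.* f ℚ.+ d ℚ.* e)
    *-assoc-re = solve 6 (λ a b c d e f →
      (a :* c :- b :* d) :* e :- (a :* d :+ b :* c) :* f :=
      a :* (c :* e :- d :* f) :- b :* (c :* f :+ d :* e)) refl

    *-assoc-im : ∀ a b c d e f →
      (a ℚ.* c ℚ.- b ℚ.* d) ℚ.* f ℚ.+ (a ℚ.* d ℚ.+ b ℚ.* c) ℚ.* e ≡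
      a ℚ.* (c ℚ.* f ℚ.+ d ℚ.* e) ℚ.+ b ℚ.* (c ℚ.* e ℚ.- d ℚ.* f)
    *-assoc-im = solve 6 (λ a b c d e f →
      (a :* c :- b :* d) :* f :+ (a :* d :+ b :* c) :* e :=
      a :* (c :* f :+ d :* e) :+ b :* (c :* e :- d :* f)) refl

    *-assoc : ∀ z w v → (z *ᶜ w) *ᶜ v ≈ z *ᶜ (w *ᶜ v)
    *-assoc z w v = mk≈
      (≗⇒≈ λ n → *-assoc-re (seq (re z) n) (seq (im z) n) (seq (re w) n) (seq (im w) n) (seq (re v) n) (seq (im v) n))
      (≗⇒≈ λ n → *-assoc-im (seq (re z) n) (seq (im z) n) (seq (re w) n) (seq (im w) n) (seq (re v) n) (seq (im v) n))

    *-comm : ∀ z w → z *ᶜ w ≈ w *ᶜ z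
    *-comm z w = mk≈
      (R.+-cong (R.*-comm (re z) (re w)) (R.-‿cong (R.*-comm (im z) (im w))))
      (R.trans (R.+-comm (re z *ᴿ im w) (im z *ᴿ re w))
        (R.+-cong (R.*-comm (im z) (re w)) (R.*-comm (re z) (im w))))

    *-cong : ∀ {z z′ w w′} → z ≈ z′ → w ≈ w′ → z *ᶜ w ≈ z′ *ᶜ w′
    *-cong (mk≈ p q) (mk≈ r s) = mk≈
      (R.+-cong (R.*-cong p r) (R.-‿cong (R.*-cong q s)))
      (R.+-cong (R.*-cong p s) (R.*-cong q r))

    *-identityˡ : ∀ z → 1ᶜ *ᶜ z ≈ z
    *-identityˡ z = mk≈
      (≗⇒≈ λ n → solve 2 (λ a b → con 1ℚ :* a :- con 0ℚ :* b := a) refl (seq (re z) n) (seq (im z) n))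
      (≗⇒≈ λ n → solve 2 (λ a b → con 1ℚ :* b :+ con 0ℚ :* a := b) refl (seq (re z) n) (seq (im z) n))

    distribˡ : ∀ z w v → z *ᶜ (w +ᶜ v) ≈ z *ᶜ w +ᶜ z *ᶜ v
    distribˡ z w v = mk≈
      (≗⇒≈ λ n → solve 6 (λ a b c d e f →
        a :* (c :+ e) :- b :* (d :+ f) := (a :* c :- b :* d) :+ (a :* e :- b :* f)) refl
        (seq (re z) n) (seq (im z) n) (seq (re w) n) (seq (im w) n) (seq (re v) n) (seq (im v) n))
      (≗⇒≈ λ n → solve 6 (λ a b c d e f →
        a :* (d :+ f) :+ b :* (c :+ e) := (a :* d :+ b :* c) :+ (a :* f :+ b :* e)) refl
        (seq (re z) n) (seq (im z) n) (seq (re w) n) (seq (im w) n) (seq (re v) n) (seq (im v) n))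

    ≈-trans = IsEquivalence.trans ≈-isEquivalence
    +-cong : ∀ {z z′ w w′} → z ≈ z′ → w ≈ w′ → z +ᶜ w ≈ z′ +ᶜ w′
    +-cong (mk≈ p q) (mk≈ r s) = mk≈ (R.+-cong p r) (R.+-cong q s)

  isCommutativeRing : IsCommutativeRing _≈_ _+ᶜ_ _*ᶜ_ -ᶜ_ 0ᶜ 1ᶜ
  isCommutativeRing = record
    { isRing = record
      { +-isAbelianGroup = record
        { isGroup = record
          { isMonoid = record
            { isSemigroup = record
              { isMagma = record { isEquivalence = ≈-isEquivalence ; ∙-cong = +-cong }
              ; assoc = λ z w v → mk≈ (R.+-assoc (re z) (re w) (re v)) (R.+-assoc (im z) (im w) (im v))
              }
            ; identity = (λ z → mk≈ (R.+-identityˡ (re z)) (R.+-identityˡ (im z)))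
                       , (λ z → mk≈ (R.+-identityʳ (re z)) (R.+-identityʳ (im z)))
            }
          ; inverse = (λ z → mk≈ (R.-‿inverseˡ (re z)) (R.-‿inverseˡ (im z)))
                    , (λ z → mk≈ (R.-‿inverseʳ (re z)) (R.-‿inverseʳ (im z)))
          ; ⁻¹-cong = λ (mk≈ p q) → mk≈ (R.-‿cong p) (R.-‿cong q)
          }
        ; comm = λ z w → mk≈ (R.+-comm (re z) (re w)) (R.+-comm (im z) (im w))
        }
      ; *-cong     = *-cong
      ; *-assoc    = *-assoc
      ; *-identity = *-identityˡ , λ z → ≈-trans (*-comm z 1ᶜ) (*-identityˡ z)
      ; distrib    = distribˡ , λ z w v → ≈-trans (*-comm (w +ᶜ v) z)
          (≈-trans (distribˡ z w v) (+-cong (*-comm z w) (*-comm z v)))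
      }
    ; *-comm = *-comm
    }

  private
    #-isApartness : IsApartnessRelation _≈_ _#_
    #-isApartness = record
      { irrefl  = λ { (mk≈ p q) (re# r) → R.#-irrefl p r
                    ; (mk≈ p q) (im# r) → R.#-irrefl q r }
      ; sym     = λ { (re# r) → re# (R.#-sym r) ; (im# r) → im# (R.#-sym r) }
      ; cotrans = λ { (re# r) z → Sum.map re# re# (R.#-cotrans r (re z))
                    ; (im# r) z → Sum.map im# im# (R.#-cotrans r (im z)) }
      }

    #-tight : Tight _≈_ _#_
    #-tight z w =
        (λ ¬z#w → mk≈ (proj₁ (R.tight (re z) (re w)) (¬z#w ∘ re#))
                      (proj₁ (R.tight (im z) (im w)) (¬z#w ∘ im#)))
      , IsApartnessRelation.irrefl #-isApartness

    x+y#0⇒x#0⊎y#0 : ∀ {x y} → x +ᴿ y R.# 0ᴿ → x R.# 0ᴿ ⊎ y R.# 0ᴿ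
    x+y#0⇒x#0⊎y#0 {x} {y} x+y#0 = Sum.map₁
      (λ x+y#y → RP.#-congʳ (≗⇒≈ λ n → solve 2 (λ a b → (a :+ b) :- b := a) refl (seq x n) (seq y n))
        (x#y⇒x-y#0 x+y#y))
      (R.#-cotrans x+y#0 y)

    xy#0⇒y#0 : ∀ {x y} → x *ᴿ y R.# 0ᴿ → y R.# 0ᴿ
    xy#0⇒y#0 {x} {y} xy#0 =
      let r , rxy≈1 , _ = R.#⇒invertible xy#0
      in RP.invertibleˡ⇒# (r *ᴿ x , R.trans
           (≗⇒≈ λ n → solve 3 (λ r a b → (r :* a) :* (b :- con 0ℚ) := r :* (a :* b :- con 0ℚ)) refl
             (seq r n) (seq x n) (seq y n))
           rxy≈1)

    #⇒inv : ∀ {z w} → z # w → Invertible _≈_ 1ᶜ _*ᶜ_ (z +ᶜ -ᶜ w)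
    #⇒inv {z} {w} z#w = u⁻¹ , ≈-trans (*-comm u⁻¹ u) uu⁻¹≈1 , uu⁻¹≈1
      where
      u = z +ᶜ -ᶜ w
      a = re u
      b = im u
      u#0 : z # w → a R.# 0ᴿ ⊎ b R.# 0ᴿ
      u#0 (re# r) = inj₁ (x#y⇒x-y#0 r)
      u#0 (im# r) = inj₂ (x#y⇒x-y#0 r)
      norm⁻¹ = R.#⇒invertible (a²+b²#0 (u#0 z#w))
      r = proj₁ norm⁻¹
      u⁻¹ : ℂ
      re u⁻¹ = a *ᴿ r
      im u⁻¹ = -ᴿ (b *ᴿ r)
      uu⁻¹≈1 : u *ᶜ u⁻¹ ≈ 1ᶜ
      uu⁻¹≈1 = mk≈
        (R.trans
          (≗⇒≈ λ n → solve 3 (λ a b r → a :* (a :* r) :- b :* :- (b :* r) :=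
                                        r :* ((a :* a :+ b :* b) :- con 0ℚ)) refl
            (seq a n) (seq b n) (seq r n))
          (proj₁ (proj₂ norm⁻¹)))
        (≗⇒≈ λ n → solve 3 (λ a b r → a :* :- (b :* r) :+ b :* (a :* r) := con 0ℚ) refl
          (seq a n) (seq b n) (seq r n))

    inv⇒# : ∀ {z w} → Invertible _≈_ 1ᶜ _*ᶜ_ (z +ᶜ -ᶜ w) → z # w
    inv⇒# {z} {w} (v , vu≈1 , _) =
      [ re# ∘ x-y#0⇒x#y ∘ xy#0⇒y#0
      , im# ∘ x-y#0⇒x#y ∘ xy#0⇒y#0
      ]′ (x+y#0⇒x#0⊎y#0 (RP.#-congʳ (R.trans (R.sym (re≈ vu≈1)) neg-out) RP.1#0))
      where
      u = z +ᶜ -ᶜ w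
      neg-out : re (v *ᶜ u) R.≈ re v *ᴿ re u +ᴿ -ᴿ (im v) *ᴿ im u
      neg-out = ≗⇒≈ λ n → solve 4 (λ a b c d → a :* c :- b :* d := a :* c :+ :- b :* d) refl
        (seq (re v) n) (seq (im v) n) (seq (re u) n) (seq (im u) n)

  isHeytingField : IsHeytingField _≈_ _#_ _+ᶜ_ _*ᶜ_ -ᶜ_ 0ᶜ 1ᶜ
  isHeytingField = record
    { isHeytingCommutativeRing = record
      { isCommutativeRing   = isCommutativeRing
      ; isApartnessRelation = #-isApartness
      ; #⇒invertible        = #⇒inv
      ; invertible⇒#        = inv⇒#
      }
    ; tight = #-tight
    }

  ℂ-heytingField : HeytingField 0ℓ 0ℓ 0ℓ
  ℂ-heytingField = record { isHeytingField = isHeytingField }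

  private
    open Algebra.Definitions.RawMonoid
      (CommutativeRing.+-rawMonoid (HeytingCommutativeRing.commutativeRing
        (HeytingField.heytingCommutativeRing ℂ-heytingField))) using (_×_)

    0≤n×1 : ∀ k n → 0ℚ ℚ.≤ seq (re (k × 1ᶜ)) n
    0≤n×1 zero    n = ℚ.≤-refl
    0≤n×1 (suc k) n = ℚ.+-mono-≤ (ℚ.nonNegative⁻¹ 1ℚ) (0≤n×1 k n)

  ℂ-char0 : CharacteristicZero ℂ-heytingField
  ℂ-char0 k = re# (1≤⇒#0 λ n →
    subst (ℚ._≤ 1ℚ ℚ.+ seq (re (k × 1ᶜ)) n) (ℚ.+-identityʳ 1ℚ) (ℚ.+-monoʳ-≤ 1ℚ (0≤n×1 k n)))

module FieldCalculus {c ℓ₁ ℓ₂} (F : HeytingField c ℓ₁ ℓ₂) (char0 : CharacteristicZero F) where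
  open HeytingField F
  open HeytingFieldProperties F
  open Algebra.Apartness.Properties.HeytingCommutativeRing heytingCommutativeRing
  private
    module CR = CommutativeRing (HeytingCommutativeRing.commutativeRing heytingCommutativeRing)
    module +-Mult = Algebra.Properties.Monoid.Mult CR.+-monoid
    module +-Group = Algebra.Properties.AbelianGroup CR.+-abelianGroup
  open Algebra.Definitions.RawSemiring (Semiring.rawSemiring CR.semiring) using (_×_; _^_) public
  open Algebra.Properties.Monoid.Sum CR.+-monoid using (sum⁺-syntax; sum-syntax) public

  fromℕ : ℕ → Carrier
  fromℕ n = n × 1#

  fromℤ : ℤ → Carrier
  fromℤ (+ n)    = fromℕ n
  fromℤ -[1+ n ] = - fromℕ (suc n)

  -- Pitfall: everything between / and ⟨ is the denominator, as in a / b * c ⟨ p ⟩.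
  infixl 7 _/_⟨_⟩

  _/_⟨_⟩ : Carrier → (d : Carrier) → d # 0# → Carrier
  a / d ⟨ d#0 ⟩ = a * proj₁ (#⇒invertible d#0)

  -- Σ_{k=0}^n, where the summand may use k ≤ n (to justify its divisions).
  sum-upTo : ∀ n → (∀ k → k ℕ.≤ n → Carrier) → Carrier
  sum-upTo n f = ∑[ i ≤ n ] f (toℕ i) (Fin.toℕ≤pred[n] i)

  falling : Carrier → ℕ → Carrier
  falling u zero    = 1#
  falling u (suc k) = falling u k * (u - fromℕ k)

  fromℕ#0 : ∀ n → .{{ℕ.NonZero n}} → fromℕ n # 0#
  fromℕ#0 (suc n) = char0 n

  binom : Carrier → ℕ → Carrier
  binom u k = falling u k / fromℕ (k ℕ.!) ⟨ fromℕ#0 (k ℕ.!) {{k ℕ.!≢0}} ⟩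

  -- u ∉ {-1, …, -n}
  NoPole : Carrier → ℕ → Set ℓ₂
  NoPole u n = ∀ j → 1 ℕ.≤ j → j ℕ.≤ n → u # - fromℕ j

  NoPole-≤ : ∀ {u k n} → k ℕ.≤ n → NoPole u n → NoPole u k
  NoPole-≤ k≤n h j 1≤j j≤k = h j 1≤j (ℕ.≤-trans j≤k k≤n)

  x#-y⇒x+y#0 : ∀ {x y} → x # - y → x + y # 0#
  x#-y⇒x+y#0 {x} {y} h = #-congʳ (CR.+-congˡ (+-Group.⁻¹-involutive y)) (x#y⇒x-y#0 h)

  x^n#0 : ∀ {x} n → x # 0# → x ^ n # 0#
  x^n#0 zero    x#0 = 1#0
  x^n#0 (suc n) x#0 = x#0y#0→xy#0 x#0 (x^n#0 n x#0)

  -- The generalized harmonic number H_n^{⟨ℓ⟩}(u); the index i of the sum is k - 1.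
  H : (ℓ n : ℕ) (u : Carrier) → NoPole u n → Carrier
  H ℓ n u h = ∑[ i < n ]
    (1# / (u + fromℕ (suc (toℕ i))) ^ ℓ
        ⟨ x^n#0 ℓ (x#-y⇒x+y#0 (h (suc (toℕ i)) (ℕ.s≤s ℕ.z≤n) (Fin.toℕ<n i))) ⟩)

  private
    open Relation.Binary.Reasoning.Setoid setoid

    fromℕ-+ : ∀ m n → fromℕ (m ℕ.+ n) ≈ fromℕ m + fromℕ n
    fromℕ-+ = +-Mult.×-homo-+ 1#

    a+b-b : ∀ a b → a + b - b ≈ a
    a+b-b a b = begin
      a + b - b     ≈⟨ CR.+-assoc a b (- b) ⟩
      a + (b - b)   ≈⟨ CR.+-congˡ (CR.-‿inverseʳ b) ⟩
      a + 0#        ≈⟨ CR.+-identityʳ a ⟩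
      a             ∎

    -- a - (m + k) + k ≈ a - m
    a-[m+k]+k : ∀ a m k → a - (m + k) + k ≈ a - m
    a-[m+k]+k a m k = begin
      a - (m + k) + k        ≈⟨ CR.+-assoc a (- (m + k)) k ⟩
      a + (- (m + k) + k)    ≈⟨ CR.+-congˡ (CR.+-congʳ (+-Group.⁻¹-∙-comm m k)) ⟨
      a + (- m - k + k)      ≈⟨ CR.+-congˡ (CR.+-assoc (- m) (- k) k) ⟩
      a + (- m + (- k + k))  ≈⟨ CR.+-congˡ (CR.+-congˡ (CR.-‿inverseˡ k)) ⟩
      a + (- m + 0#)         ≈⟨ CR.+-congˡ (CR.+-identityʳ (- m)) ⟩
      a - m                  ∎

    falling#0 : ∀ {u} k → (∀ j → j ℕ.< k → u # fromℕ j) → falling u k # 0#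
    falling#0 zero    h = 1#0
    falling#0 (suc k) h = x#0y#0→xy#0
      (falling#0 k (λ j j<k → h j (ℕ.m<n⇒m<1+n j<k)))
      (x#y⇒x-y#0 (h k (ℕ.n<1+n k)))

    /#0 : ∀ {a d} → a # 0# → (d#0 : d # 0#) → a / d ⟨ d#0 ⟩ # 0#
    /#0 {a} {d} a#0 d#0 =
      let r , r*d≈1 , d*r≈1 = #⇒invertible d#0
      in x#0y#0→xy#0 a#0 (invertibleʳ⇒# (d - 0# , CR.trans (CR.*-congʳ (x-0≈x r)) r*d≈1))

  binom#0 : ∀ {u} k → (∀ j → j ℕ.< k → u # fromℕ j) → binom u k # 0#
  binom#0 k h = /#0 (falling#0 k h) (fromℕ#0 (k ℕ.!) {{k ℕ.!≢0}})

  1+u#0 : ∀ {u n} → 1 ℕ.≤ n → NoPole u n → 1# + u # 0#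
  1+u#0 {u} 1≤n h = #-congʳ
    (CR.trans (CR.+-congˡ (CR.+-identityʳ 1#)) (CR.+-comm u 1#))
    (x#-y⇒x+y#0 (h 1 ℕ.≤-refl 1≤n))

  1+x-y#0 : ∀ {x y n} → 2 ℕ.≤ n → NoPole (x - y) n → 1# + x - y # 0#
  1+x-y#0 {x} {y} 2≤n h = #-congʳ (CR.sym (CR.+-assoc 1# x (- y)))
    (1+u#0 (ℕ.≤-trans (ℕ.n≤1+n 1) 2≤n) h)

  2n[n-1]#0 : ∀ {n} → 2 ℕ.≤ n → fromℕ 2 * fromℕ n * (fromℕ n - 1#) # 0#
  2n[n-1]#0 {suc (suc m)} (ℕ.s≤s (ℕ.s≤s _)) =
    x#0y#0→xy#0 (x#0y#0→xy#0 (char0 1) (char0 (suc m)))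
      (#-congʳ (CR.sym (CR.trans (CR.+-congʳ (CR.+-comm 1# (fromℕ (suc m)))) (a+b-b _ 1#)))
        (char0 m))

  binom[x+n,n]#0 : ∀ {x n} → NoPole x n → binom (x + fromℕ n) n # 0#
  binom[x+n,n]#0 {x} {n} h = binom#0 n λ j j<n → x-y#0⇒x#y
    (#-congʳ (CR.sym (eq j (ℕ.<⇒≤ j<n)))
      (x#-y⇒x+y#0 (h (n ℕ.∸ j) (ℕ.m<n⇒0<n∸m j<n) (ℕ.m∸n≤m n j))))
    where
    eq : ∀ j → j ℕ.≤ n → x + fromℕ n - fromℕ j ≈ x + fromℕ (n ℕ.∸ j)
    eq j j≤n = begin
      x + fromℕ n - fromℕ j
        ≡⟨ cong (λ m → x + fromℕ m - fromℕ j) (ℕ.m∸n+n≡m j≤n) ⟨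
      x + fromℕ (n ℕ.∸ j ℕ.+ j) - fromℕ j
        ≈⟨ CR.+-congʳ (CR.+-congˡ (fromℕ-+ (n ℕ.∸ j) j)) ⟩
      x + (fromℕ (n ℕ.∸ j) + fromℕ j) - fromℕ j
        ≈⟨ CR.+-congʳ (CR.+-assoc x _ _) ⟨
      x + fromℕ (n ℕ.∸ j) + fromℕ j - fromℕ j
        ≈⟨ a+b-b _ _ ⟩
      x + fromℕ (n ℕ.∸ j) ∎

  -- y ∉ {-n, -n+1, …, n-1}
  OffRange : Carrier → ℕ → Set ℓ₂
  OffRange y n = ∀ i → ℤ.- (+ n) ℤ.≤ i → i ℤ.< + n → y # fromℤ i

  module _ {y n} (h : OffRange y n) where
    private
      y#j : ∀ j → j ℕ.< n → y # fromℕ j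
      y#j j j<n = h (+ j) (ℤ.≤-trans (ℤ.neg-mono-≤ (ℤ.+≤+ ℕ.z≤n)) (ℤ.+≤+ ℕ.z≤n)) (ℤ.+<+ j<n)

      y#-suc : ∀ j → suc j ℕ.≤ n → y # - fromℕ (suc j)
      y#-suc j 1+j≤n = h -[1+ j ] (ℤ.neg-mono-≤ (ℤ.+≤+ 1+j≤n)) ℤ.-<+

      y+k#0 : ∀ k → k ℕ.≤ n → 1 ℕ.≤ n → y + fromℕ k # 0#
      y+k#0 zero    _   1≤n = #-congʳ (CR.sym (CR.+-identityʳ y)) (y#j 0 1≤n)
      y+k#0 (suc k) k≤n _   = x#-y⇒x+y#0 (y#-suc k k≤n)

      y+k-1#0 : ∀ k → k ℕ.≤ n → 2 ℕ.≤ n → y + fromℕ k - 1# # 0#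
      y+k-1#0 zero    _   2≤n = #-congʳ (CR.+-congʳ (CR.sym (CR.+-identityʳ y)))
        (x#y⇒x-y#0 (#-congˡ (CR.+-identityʳ 1#) (y#j 1 2≤n)))
      y+k-1#0 (suc k) k<n 2≤n = #-congʳ (CR.sym eq)
        (y+k#0 k (ℕ.<⇒≤ k<n) (ℕ.≤-trans (ℕ.n≤1+n 1) 2≤n))
        where
        eq : y + (1# + fromℕ k) - 1# ≈ y + fromℕ k
        eq = begin
          y + (1# + fromℕ k) - 1#  ≈⟨ CR.+-congʳ (CR.+-congˡ (CR.+-comm 1# (fromℕ k))) ⟩
          y + (fromℕ k + 1#) - 1#  ≈⟨ CR.+-congʳ (CR.+-assoc y (fromℕ k) 1#) ⟨
          y + fromℕ k + 1# - 1#    ≈⟨ a+b-b _ 1# ⟩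
          y + fromℕ k              ∎

    [y+k-1][y+k]#0 : ∀ {k} → 2 ℕ.≤ n → k ℕ.≤ n → (y + fromℕ k - 1#) * (y + fromℕ k) # 0#
    [y+k-1][y+k]#0 {k} 2≤n k≤n =
      x#0y#0→xy#0 (y+k-1#0 k k≤n 2≤n) (y+k#0 k k≤n (ℕ.≤-trans (ℕ.n≤1+n 1) 2≤n))

    binom[y,n]#0 : binom y n # 0#
    binom[y,n]#0 = binom#0 n y#j

    binom[y-n+k,k]#0 : ∀ {k} → k ℕ.≤ n → binom (y - fromℕ n + fromℕ k) k # 0#
    binom[y-n+k,k]#0 {k} k≤n = binom#0 k λ j j<k → x-y#0⇒x#y
      (#-congʳ (CR.sym (eq j)) (x#y⇒x-y#0 (y#j (n ℕ.∸ k ℕ.+ j)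
        (subst (n ℕ.∸ k ℕ.+ j ℕ.<_) (ℕ.m∸n+n≡m k≤n) (ℕ.+-monoʳ-< (n ℕ.∸ k) j<k)))))
      where
      eq : ∀ j → y - fromℕ n + fromℕ k - fromℕ j ≈ y - fromℕ (n ℕ.∸ k ℕ.+ j)
      eq j = begin
        y - fromℕ n + fromℕ k - fromℕ j
          ≡⟨ cong (λ m → y - fromℕ m + fromℕ k - fromℕ j) (ℕ.m∸n+n≡m k≤n) ⟨
        y - fromℕ (n ℕ.∸ k ℕ.+ k) + fromℕ k - fromℕ j
          ≈⟨ CR.+-congʳ (CR.+-congʳ (CR.+-congˡ (CR.-‿cong (fromℕ-+ (n ℕ.∸ k) k)))) ⟩
        y - (fromℕ (n ℕ.∸ k) + fromℕ k) + fromℕ k - fromℕ j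
          ≈⟨ CR.+-congʳ (a-[m+k]+k y _ _) ⟩
        y - fromℕ (n ℕ.∸ k) - fromℕ j
          ≈⟨ CR.+-assoc y _ _ ⟩
        y + (- fromℕ (n ℕ.∸ k) - fromℕ j)
          ≈⟨ CR.+-congˡ (+-Group.⁻¹-∙-comm _ _) ⟩
        y - (fromℕ (n ℕ.∸ k) + fromℕ j)
          ≈⟨ CR.+-congˡ (CR.-‿cong (fromℕ-+ (n ℕ.∸ k) j)) ⟨
        y - fromℕ (n ℕ.∸ k ℕ.+ j) ∎

  *#0 : ∀ {a b} → a # 0# → b # 0# → a * b # 0#
  *#0 = x#0y#0→xy#0

open Complexes public using (ℂ)
open HeytingField Complexes.ℂ-heytingField public
  using (_≈_; _#_; _+_; _*_; -_; _-_; 0#; 1#)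
open FieldCalculus Complexes.ℂ-heytingField Complexes.ℂ-char0 public

{-# OPTIONS --safe #-}

-- Write the k-th coefficient on the left as c_k = (-1)^k C(n,k) q(k) / q(0) with the polynomial
-- q(k) = (k+y-2)(k+y-3)⋯(k+y-n+1) of degree n-2. These terms are Gosper summable: their tails are
-- T_j = (-1)^(j-1) C(n-1,j-1) p(j), up to a constant factor, with p a product of n linear factors.
-- Summation by parts turns the left-hand side into Σ_j T_j / (x+j)^3, an alternating binomial sum
-- (a finite difference of order n-1) of a polynomial times a power of 1/(x+j). Such a sum is built up
-- one linear factor b+i at a time from the sums of 1/(x+j)^ℓ by
--   (b+i)/(z+i)^(ℓ+1) = 1/(z+i)^ℓ + (b-z)/(z+i)^(ℓ+1),
-- which on generating functions in ℓ is the multiplication by a linear polynomial. So the value for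
-- ℓ = 3 is half the second derivative of a product f of linear factors and their reciprocals, that is
-- f (s² + s′) / 2 with s the logarithmic derivative of f.
module Submission where

open import Algebra.Apartness.Bundles using (HeytingCommutativeRing; HeytingField)
import Algebra.Apartness.Properties.HeytingCommutativeRing
open import Algebra.Bundles using (CommutativeRing; Semiring)
import Algebra.Definitions.RawSemiring
import Algebra.Properties.AbelianGroup
import Algebra.Properties.CommutativeSemiring.Exp
import Algebra.Properties.Monoid.Sum
import Algebra.Properties.Ring
import Algebra.Properties.Semiring.Exp
import Algebra.Properties.Semiring.Mult
import Algebra.Properties.Semiring.Mult.TCOptimised
import Algebra.Properties.Semiring.Sum
import Algebra.Solver.Ring
open import Algebra.Solver.Ring.AlmostCommutativeRing
  using (fromCommutativeRing; _-Raw-AlmostCommutative⟶_)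
open import Data.Fin.Base as Fin using (Fin; toℕ)
import Data.Fin.Properties as Fin
open import Data.Integer.Base as ℤ using (ℤ; +_; -[1+_])
import Data.Integer.Properties as ℤ
open import Data.Maybe.Base using (map)
open import Data.Nat.Base as ℕ using (ℕ; zero; suc; pred; z≤n; s≤s; _≤_)
import Data.Nat.Properties as ℕ
open import Data.Product.Base using (proj₁; proj₂)
open import Defs using (CharacteristicZero; module FieldCalculus)
import Relation.Binary.PropositionalEquality as ≡
import Relation.Binary.Reasoning.Setoid
open import Relation.Nullary using (yes; no; contradiction)
open import Relation.Nullary.Decidable using (dec⇒maybe)

-- Normalisation of polynomial identities with integer coefficients in a commutative ring.

module IntegerRingSolver {c ℓ} (R : CommutativeRing c ℓ) where
  open CommutativeRing R
  open Algebra.Properties.Ring ring using (-‿distribˡ-*; -0#≈0#; -‿involutive)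
  open Algebra.Properties.AbelianGroup +-abelianGroup using (⁻¹-∙-comm)
  open Algebra.Properties.Semiring.Mult.TCOptimised semiring using (_×_; 1+×; ×-homo-+; ×1-homo-*)
  open Relation.Binary.Reasoning.Setoid setoid

  -- With this form of `_×_` the numeral 1 denotes `1#` itself rather than `1# + 0#`, so constants
  -- in solver expressions match the goals on the nose.
  ⟦_⟧ᶻ : ℤ → Carrier
  ⟦ + n ⟧ᶻ      = n × 1#
  ⟦ -[1+ n ] ⟧ᶻ = - (suc n × 1#)

  neg-homo : ∀ i → ⟦ ℤ.- i ⟧ᶻ ≈ - ⟦ i ⟧ᶻ
  neg-homo (+ zero)  = sym -0#≈0#
  neg-homo (+ suc n) = refl
  neg-homo -[1+ n ]  = sym (-‿involutive _)

  ⊖-homo : ∀ m n → ⟦ m ℤ.⊖ n ⟧ᶻ ≈ m × 1# - n × 1#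
  ⊖-homo m       zero    = sym (trans (+-congˡ -0#≈0#) (+-identityʳ _))
  ⊖-homo zero    (suc n) = sym (+-identityˡ _)
  ⊖-homo (suc m) (suc n) = begin
    ⟦ suc m ℤ.⊖ suc n ⟧ᶻ                ≡⟨ ≡.cong ⟦_⟧ᶻ (ℤ.[1+m]⊖[1+n]≡m⊖n m n) ⟩
    ⟦ m ℤ.⊖ n ⟧ᶻ                        ≈⟨ ⊖-homo m n ⟩
    m × 1# - n × 1#                     ≈⟨ +-congˡ (+-identityˡ _) ⟨
    m × 1# + (0# - n × 1#)              ≈⟨ +-congˡ (+-congʳ (-‿inverseʳ 1#)) ⟨
    m × 1# + (1# - 1# - n × 1#)         ≈⟨ +-congˡ (+-assoc 1# _ _) ⟩
    m × 1# + (1# + (- 1# - n × 1#))     ≈⟨ +-assoc _ 1# _ ⟨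
    (m × 1# + 1#) + (- 1# - n × 1#)     ≈⟨ +-cong (+-comm _ 1#) (⁻¹-∙-comm 1# _) ⟩
    (1# + m × 1#) - (1# + n × 1#)       ≈⟨ +-cong (1+× m 1#) (-‿cong (1+× n 1#)) ⟨
    suc m × 1# - suc n × 1#             ∎

  +-homo : ∀ i j → ⟦ i ℤ.+ j ⟧ᶻ ≈ ⟦ i ⟧ᶻ + ⟦ j ⟧ᶻ
  +-homo (+ m)    (+ n)    = ×-homo-+ 1# m n
  +-homo (+ m)    -[1+ n ] = ⊖-homo m (suc n)
  +-homo -[1+ m ] (+ n)    = trans (⊖-homo n (suc m)) (+-comm _ _)
  +-homo -[1+ m ] -[1+ n ] = begin
    - (suc (suc (m ℕ.+ n)) × 1#)      ≡⟨ ≡.cong (λ k → - (suc k × 1#)) (ℕ.+-suc m n) ⟨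
    - ((suc m ℕ.+ suc n) × 1#)        ≈⟨ -‿cong (×-homo-+ 1# (suc m) (suc n)) ⟩
    - (suc m × 1# + suc n × 1#)       ≈⟨ ⁻¹-∙-comm _ _ ⟨
    - (suc m × 1#) - suc n × 1#       ∎

  pos-*-homo : ∀ m j → ⟦ + m ℤ.* j ⟧ᶻ ≈ m × 1# * ⟦ j ⟧ᶻ
  pos-*-homo m (+ n) = trans (reflexive (≡.cong ⟦_⟧ᶻ (≡.sym (ℤ.pos-* m n)))) (×1-homo-* m n)
  pos-*-homo m -[1+ n ] = begin
    ⟦ + m ℤ.* -[1+ n ] ⟧ᶻ              ≡⟨ ≡.cong ⟦_⟧ᶻ (ℤ.neg-distribʳ-* (+ m) (+ suc n)) ⟨
    ⟦ ℤ.- (+ m ℤ.* + suc n) ⟧ᶻ         ≈⟨ neg-homo (+ m ℤ.* + suc n) ⟩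
    - ⟦ + m ℤ.* + suc n ⟧ᶻ             ≈⟨ -‿cong (pos-*-homo m (+ suc n)) ⟩
    - (m × 1# * suc n × 1#)            ≈⟨ -‿cong (*-comm _ _) ⟩
    - (suc n × 1# * m × 1#)            ≈⟨ -‿distribˡ-* _ _ ⟩
    - (suc n × 1#) * m × 1#            ≈⟨ *-comm _ _ ⟩
    m × 1# * - (suc n × 1#)            ∎

  *-homo : ∀ i j → ⟦ i ℤ.* j ⟧ᶻ ≈ ⟦ i ⟧ᶻ * ⟦ j ⟧ᶻ
  *-homo (+ m)    j = pos-*-homo m j
  *-homo -[1+ m ] j = begin
    ⟦ -[1+ m ] ℤ.* j ⟧ᶻ         ≡⟨ ≡.cong ⟦_⟧ᶻ (ℤ.neg-distribˡ-* (+ suc m) j) ⟨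
    ⟦ ℤ.- (+ suc m ℤ.* j) ⟧ᶻ    ≈⟨ neg-homo (+ suc m ℤ.* j) ⟩
    - ⟦ + suc m ℤ.* j ⟧ᶻ        ≈⟨ -‿cong (pos-*-homo (suc m) j) ⟩
    - (suc m × 1# * ⟦ j ⟧ᶻ)     ≈⟨ -‿distribˡ-* _ _ ⟩
    - (suc m × 1#) * ⟦ j ⟧ᶻ     ∎

  ℤ⟶R : ℤ.+-*-rawRing -Raw-AlmostCommutative⟶ fromCommutativeRing R
  ℤ⟶R = record
    { ⟦_⟧ = ⟦_⟧ᶻ ; +-homo = +-homo ; *-homo = *-homo ; -‿homo = neg-homo
    ; 0-homo = refl ; 1-homo = refl }

  open Algebra.Solver.Ring ℤ.+-*-rawRing (fromCommutativeRing R) ℤ⟶R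
    (λ i j → map (λ i≡j → reflexive (≡.cong ⟦_⟧ᶻ i≡j)) (dec⇒maybe (i ℤ.≟ j))) public

-- Alternating binomial sums as iterated differences.

module AlternatingSums {c ℓ} (R : CommutativeRing c ℓ) where
  open CommutativeRing R
  open IntegerRingSolver R
  open Algebra.Definitions.RawSemiring (Semiring.rawSemiring semiring) using (_×_; _^_)
  open Algebra.Properties.Monoid.Sum +-monoid using (sum)
  open Relation.Binary.Reasoning.Setoid setoid

  𝟘 𝟙 : ∀ {k} → Polynomial k
  𝟘 = con (+ 0)
  𝟙 = con (+ 1)

  -- (1 - E)^m f at 0, where E is the shift: Σ_i (-1)^i C(m,i) f(i).
  Δ : ℕ → (ℕ → Carrier) → Carrier
  Δ zero    f = f 0
  Δ (suc m) f = Δ m f - Δ m (λ i → f (suc i))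

  Δ-cong : ∀ m {f g} → (∀ i → i ℕ.≤ m → f i ≈ g i) → Δ m f ≈ Δ m g
  Δ-cong zero    f≈g = f≈g 0 z≤n
  Δ-cong (suc m) f≈g = +-cong (Δ-cong m λ i i≤m → f≈g i (ℕ.m≤n⇒m≤1+n i≤m))
                              (-‿cong (Δ-cong m λ i i≤m → f≈g (suc i) (s≤s i≤m)))

  Δ-+ : ∀ m f g → Δ m (λ i → f i + g i) ≈ Δ m f + Δ m g
  Δ-+ zero    f g = refl
  Δ-+ (suc m) f g = trans (+-cong (Δ-+ m f g) (-‿cong (Δ-+ m _ _)))
    (solve 4 (λ a b c d → (a :+ b) :- (c :+ d) := (a :- c) :+ (b :- d)) refl _ _ _ _)

  Δ-*ˡ : ∀ m a f → Δ m (λ i → a * f i) ≈ a * Δ m f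
  Δ-*ˡ zero    a f = refl
  Δ-*ˡ (suc m) a f = trans (+-cong (Δ-*ˡ m a f) (-‿cong (Δ-*ˡ m a _)))
    (solve 3 (λ a b c → a :* b :- a :* c := a :* (b :- c)) refl _ _ _)

  Δ-- : ∀ m f g → Δ m (λ i → f i - g i) ≈ Δ m f - Δ m g
  Δ-- m f g = trans (Δ-+ m f (λ i → - g i)) (+-congˡ (begin
    Δ m (λ i → - g i)        ≈⟨ Δ-cong m (λ i _ → solve 1 (λ a → :- a := (:- 𝟙) :* a) refl (g i)) ⟩
    Δ m (λ i → - 1# * g i)   ≈⟨ Δ-*ˡ m (- 1#) g ⟩
    - 1# * Δ m g             ≈⟨ solve 1 (λ a → (:- 𝟙) :* a := :- a) refl (Δ m g) ⟩
    - Δ m g                  ∎))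

  -- The factor `m × 1#` extends the recursion of `Δ` to `m = 0`, where `pred` does not undo a
  -- `suc`.
  pascal : ∀ m f → m × 1# * Δ m f ≈ m × 1# * (Δ (pred m) f - Δ (pred m) (λ i → f (suc i)))
  pascal zero    f = trans (zeroˡ _) (sym (zeroˡ _))
  pascal (suc m) f = refl

  -- Moving multiplication by `i` past `(1 - E)^m` leaves the commutator `- m E (1 - E)^(m-1)`. With
  -- `E = 1 - (1 - E)` and evaluation at 0, this gives the two terms on the right.
  Δ-leibniz : ∀ m b f → Δ m (λ i → (b + i × 1#) * f i) ≈ (b + m × 1#) * Δ m f - m × 1# * Δ (pred m) f
  Δ-leibniz zero    b f = solve 3 (λ b x y → (b :+ 𝟘) :* x := (b :+ 𝟘) :* x :- 𝟘 :* y) refl b (f 0) (f 0)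
  Δ-leibniz (suc m) b f = begin
    Δ m (λ i → (b + i × 1#) * f i) - Δ m (λ i → (b + suc i × 1#) * f (suc i))
      ≈⟨ +-cong (Δ-leibniz m b f) (-‿cong (trans (Δ-cong m λ i _ → *-congʳ (sym (+-assoc b 1# _)))
           (Δ-leibniz m (b + 1#) (λ i → f (suc i))))) ⟩
    ((b + m × 1#) * u - m × 1# * u′) - ((b + 1# + m × 1#) * v - m × 1# * v′)
      ≈⟨ solve 6 (λ b m u u′ v v′ → ((b :+ m) :* u :- m :* u′) :- ((b :+ 𝟙 :+ m) :* v :- m :* v′)
           := (b :+ m) :* u :- (b :+ 𝟙 :+ m) :* v :- m :* (u′ :- v′)) refl b (m × 1#) u u′ v v′ ⟩
    (b + m × 1#) * u - (b + 1# + m × 1#) * v - m × 1# * (u′ - v′)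
      ≈⟨ +-congˡ (-‿cong (pascal m f)) ⟨
    (b + m × 1#) * u - (b + 1# + m × 1#) * v - m × 1# * u
      ≈⟨ solve 4 (λ b m u v → (b :+ m) :* u :- (b :+ 𝟙 :+ m) :* v :- m :* u
           := (b :+ (𝟙 :+ m)) :* (u :- v) :- (𝟙 :+ m) :* u) refl b (m × 1#) u v ⟩
    (b + suc m × 1#) * (u - v) - suc m × 1# * u ∎
    where
    u = Δ m f
    v = Δ m (λ i → f (suc i))
    u′ = Δ (pred m) f
    v′ = Δ (pred m) (λ i → f (suc i))

  Δ-leibniz₂ : ∀ m a b f → Δ (suc m) (λ i → (a + i × 1#) * ((b + i × 1#) * f i)) ≈
    (a + suc m × 1#) * ((b + suc m × 1#) * Δ (suc m) f - suc m × 1# * Δ m f)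
      - suc m × 1# * ((b + m × 1#) * Δ m f - m × 1# * Δ (pred m) f)
  Δ-leibniz₂ m a b f = trans (Δ-leibniz (suc m) a _)
    (+-cong (*-congˡ (Δ-leibniz (suc m) b f)) (-‿cong (*-congˡ (Δ-leibniz m b f))))

  -- An operator form of Gosper's summation of the hypergeometric terms of the theorem.
  Δ-gosper : ∀ m y g → let M = suc m × 1# in
    M * (y * (y - 1#)) * Δ (2 ℕ.+ m) g ≈
    Δ (suc m) (λ i → (- (M * y) + i × 1#) * ((y - M + i × 1#) * g (suc i)))
      - Δ (suc m) (λ i → (- (M * y) + i × 1#) * ((y - 1# + i × 1#) * g i))
  Δ-gosper m y g = begin
    M * (y * (y - 1#)) * Δ (2 ℕ.+ m) g
      ≈⟨ solve 6 (λ k y d₀ d₁ d₂ d₃ → let M = 𝟙 :+ k ; a = :- 𝟙 :- M :* y ; b = y :- M :- 𝟙 in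
           M :* (y :* (y :- 𝟙)) :* d₀
           := (((a :+ M) :* ((b :+ M) :* d₁ :- M :* d₂) :- M :* ((b :+ k) :* d₂ :- k :* d₃))
              :- ((a :+ (𝟙 :+ M)) :* ((b :+ (𝟙 :+ M)) :* d₀ :- (𝟙 :+ M) :* d₁)
                  :- (𝟙 :+ M) :* ((b :+ M) :* d₁ :- M :* d₂)))
              :- ((:- (M :* y) :+ M) :* ((y :- 𝟙 :+ M) :* d₁ :- M :* d₂)
                  :- M :* ((y :- 𝟙 :+ k) :* d₂ :- k :* d₃)))
           refl (m × 1#) y (Δ (2 ℕ.+ m) g) (Δ (suc m) g) (Δ m g) (Δ (pred m) g) ⟩
    _ ≈⟨ +-cong (+-cong (Δ-leibniz₂ m a b g) (-‿cong (Δ-leibniz₂ (suc m) a b g)))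
                (-‿cong (Δ-leibniz₂ m (- (M * y)) (y - 1#) g)) ⟨
    (Δ (suc m) φ - Δ (2 ℕ.+ m) φ) - Δ (suc m) ψ
      ≈⟨ +-congʳ (solve 2 (λ u v → u :- (u :- v) := v) refl (Δ (suc m) φ) (Δ (suc m) (λ i → φ (suc i)))) ⟩
    Δ (suc m) (λ i → φ (suc i)) - Δ (suc m) ψ
      ≈⟨ +-congʳ (Δ-cong (suc m) λ i _ →
           solve 4 (λ M y i g → (:- 𝟙 :- M :* y :+ (𝟙 :+ i)) :* ((y :- M :- 𝟙 :+ (𝟙 :+ i)) :* g)
             := (:- (M :* y) :+ i) :* ((y :- M :+ i) :* g)) refl M y (i × 1#) (g (suc i))) ⟩
    Δ (suc m) (λ i → (- (M * y) + i × 1#) * ((y - M + i × 1#) * g (suc i))) - Δ (suc m) ψ ∎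
    where
    M = suc m × 1#
    -- Both constants are lowered by one, so that `φ (suc i)` is the first summand of the claim.
    -- Every sum then involves `g` unshifted, and `Δ-leibniz₂` reduces the claim to a polynomial
    -- identity in the differences of `g` of orders `2 + m` to `pred m`.
    a = - 1# - M * y
    b = y - M - 1#
    φ ψ : ℕ → Carrier
    φ i = (a + i × 1#) * ((b + i × 1#) * g i)
    ψ i = (- (M * y) + i × 1#) * ((y - 1# + i × 1#) * g i)

  -- The last term is split off by definition, so increments of partial sums such as harmonic
  -- numbers compute.
  ∑< : ℕ → (ℕ → Carrier) → Carrier
  ∑< zero    f = 0#
  ∑< (suc n) f = ∑< n f + f n

  ∑<-cong : ∀ n {f g} → (∀ i → i ℕ.< n → f i ≈ g i) → ∑< n f ≈ ∑< n g
  ∑<-cong zero    f≈g = refl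
  ∑<-cong (suc n) f≈g = +-cong (∑<-cong n λ i i<n → f≈g i (ℕ.m<n⇒m<1+n i<n)) (f≈g n ℕ.≤-refl)

  ∑<-suc : ∀ n f → ∑< (suc n) f ≈ f 0 + ∑< n (λ i → f (suc i))
  ∑<-suc zero    f = +-comm _ _
  ∑<-suc (suc n) f = trans (+-congʳ (∑<-suc n f)) (+-assoc _ _ _)

  ∑<-*ʳ : ∀ n f a → ∑< n f * a ≈ ∑< n (λ i → f i * a)
  ∑<-*ʳ zero    f a = zeroˡ a
  ∑<-*ʳ (suc n) f a = trans (distribʳ a _ _) (+-congʳ (∑<-*ʳ n f a))

  ∑<-neg : ∀ n f → ∑< n (λ i → - f i) ≈ - ∑< n f
  ∑<-neg zero    f = solve 0 (𝟘 := :- 𝟘) refl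
  ∑<-neg (suc n) f = trans (+-congʳ (∑<-neg n f)) (solve 2 (λ a b → :- a :+ :- b := :- (a :+ b)) refl _ _)

  sum≈∑< : ∀ {n} (t : Fin n → Carrier) f → (∀ i → t i ≈ f (toℕ i)) → sum t ≈ ∑< n f
  sum≈∑< {zero}  t f t≈f = refl
  sum≈∑< {suc n} t f t≈f = trans
    (+-cong (t≈f Fin.zero) (sum≈∑< (λ i → t (Fin.suc i)) (λ i → f (suc i)) (λ i → t≈f (Fin.suc i))))
    (sym (∑<-suc n f))

  -- Polynomials and their vanishing differences.

  -- Δ m annihilates polynomials of degree less than m.
  Degree≤ : ℕ → (ℕ → Carrier) → Set ℓ
  Degree≤ d f = ∀ m → d ℕ.< m → Δ m f ≈ 0#

  Degree≤-const : ∀ a → Degree≤ 0 (λ _ → a)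
  Degree≤-const a (suc m) _ = -‿inverseʳ _

  Degree≤-linear* : ∀ {d f} b → Degree≤ d f → Degree≤ (suc d) (λ i → (b + i × 1#) * f i)
  Degree≤-linear* {f = f} b f≤d (suc m) (s≤s d<m) = begin
    Δ (suc m) (λ i → (b + i × 1#) * f i)
      ≈⟨ Δ-leibniz (suc m) b f ⟩
    (b + suc m × 1#) * Δ (suc m) f - suc m × 1# * Δ m f
      ≈⟨ +-cong (*-congˡ (f≤d (suc m) (ℕ.m<n⇒m<1+n d<m))) (-‿cong (*-congˡ (f≤d m d<m))) ⟩
    (b + suc m × 1#) * 0# - suc m × 1# * 0#
      ≈⟨ solve 2 (λ u v → u :* 𝟘 :- v :* 𝟘 := 𝟘) refl _ _ ⟩
    0# ∎

  -- This is `Δ-leibniz` for the product `(z + i) f i`, solved for the highest difference of `f`. It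
  -- yields recursions in `m` for differences of functions with the denominator `z + i`.
  Δ-quotient : ∀ m {z r f g} → (z + suc m × 1#) * r ≈ 1# →
    (∀ i → i ℕ.≤ suc m → (z + i × 1#) * f i ≈ g i) →
    Δ (suc m) f ≈ r * (Δ (suc m) g + suc m × 1# * Δ m f)
  Δ-quotient m {z} {r} {f} {g} [z+m]r≈1 [z+i]f≈g = begin
    Δ (suc m) f
      ≈⟨ *-identityˡ _ ⟨
    1# * Δ (suc m) f
      ≈⟨ *-congʳ [z+m]r≈1 ⟨
    (z + suc m × 1#) * r * Δ (suc m) f
      ≈⟨ solve 5 (λ a r M u v → a :* r :* u := r :* (a :* u :- M :* v :+ M :* v)) refl
           (z + suc m × 1#) r (suc m × 1#) (Δ (suc m) f) (Δ m f) ⟩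
    r * ((z + suc m × 1#) * Δ (suc m) f - suc m × 1# * Δ m f + suc m × 1# * Δ m f)
      ≈⟨ *-congˡ (+-congʳ (Δ-leibniz (suc m) z f)) ⟨
    r * (Δ (suc m) (λ i → (z + i × 1#) * f i) + suc m × 1# * Δ m f)
      ≈⟨ *-congˡ (+-congʳ (Δ-cong (suc m) [z+i]f≈g)) ⟩
    r * (Δ (suc m) g + suc m × 1# * Δ m f) ∎

  -- Generating functions of sums of reciprocal powers.

  -- The coefficients of Δ m (h r / (1 - ε r)) modulo ε³: if r is 1/(z+i), this is Δ m (h/(z+i-ε)),
  -- and q, s, t are its value, its logarithmic derivative and the derivative of the latter at ε = 0.
  record Moments (m : ℕ) (r h : ℕ → Carrier) (q s t : Carrier) : Set ℓ where
    field
      first  : Δ m (λ i → h i * r i ^ 1) ≈ q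
      second : Δ m (λ i → h i * r i ^ 2) ≈ q * s
      third  : (1# + 1#) * Δ m (λ i → h i * r i ^ 3) ≈ q * (s ^ 2 + t)

  -- m! / (z (z + 1) ⋯ (z + m)) when r is 1/(z+i)
  residue : (ℕ → Carrier) → ℕ → Carrier
  residue r zero    = r 0
  residue r (suc m) = suc m × 1# * r (suc m) * residue r m

  Reciprocals : ℕ → Carrier → (ℕ → Carrier) → Set ℓ
  Reciprocals m z r = ∀ i → i ℕ.≤ m → (z + i × 1#) * r i ≈ 1#

  -- By partial fractions, the difference of order `m` of `1/(z+i-ε)` is `m!` divided by the product
  -- of the `z+i-ε` for `i ≤ m`. Its logarithmic derivative at `ε = 0` is the sum of the `r i`, and
  -- the derivative of the latter is the sum of their squares. The induction on `m` treats the
  -- powers one after the other, by `Δ-quotient`.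
  reciprocal-moments : ∀ m {z r} → Reciprocals m z r →
    Moments m r (λ _ → 1#) (residue r m) (∑< (suc m) r) (∑< (suc m) (λ i → r i ^ 2))
  reciprocal-moments zero {r = r} _ = record
    { first  = solve 1 (λ r → 𝟙 :* r :^ 1 := r) refl (r 0)
    ; second = solve 1 (λ r → 𝟙 :* r :^ 2 := r :* (𝟘 :+ r)) refl (r 0)
    ; third  = solve 1 (λ r → (𝟙 :+ 𝟙) :* (𝟙 :* r :^ 3) := r :* ((𝟘 :+ r) :^ 2 :+ (𝟘 :+ r :^ 2))) refl (r 0)
    }
  reciprocal-moments (suc m) {z} {r} zr≈1 = record
    { first  = first′
    ; second = second′
    ; third  = begin
        (1# + 1#) * Δ (suc m) (λ i → 1# * r i ^ 3)
          ≈⟨ *-congˡ (step 2) ⟩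
        (1# + 1#) * (ρ * (Δ (suc m) (λ i → 1# * r i ^ 2) + M * Δ m (λ i → 1# * r i ^ 3)))
          ≈⟨ *-congˡ (*-congˡ (+-congʳ second′)) ⟩
        (1# + 1#) * (ρ * (M * ρ * G * (s + ρ) + M * Δ m (λ i → 1# * r i ^ 3)))
          ≈⟨ solve 5 (λ ρ M G s v → (𝟙 :+ 𝟙) :* (ρ :* (M :* ρ :* G :* (s :+ ρ) :+ M :* v))
               := ρ :* ((𝟙 :+ 𝟙) :* (M :* ρ :* G :* (s :+ ρ)) :+ M :* ((𝟙 :+ 𝟙) :* v)))
               refl ρ M G s (Δ m (λ i → 1# * r i ^ 3)) ⟩
        ρ * ((1# + 1#) * (M * ρ * G * (s + ρ)) + M * ((1# + 1#) * Δ m (λ i → 1# * r i ^ 3)))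
          ≈⟨ *-congˡ (+-congˡ (*-congˡ (Moments.third ih))) ⟩
        ρ * ((1# + 1#) * (M * ρ * G * (s + ρ)) + M * (G * (s ^ 2 + t)))
          ≈⟨ solve 5 (λ ρ M G s t → ρ :* ((𝟙 :+ 𝟙) :* (M :* ρ :* G :* (s :+ ρ)) :+ M :* (G :* (s :^ 2 :+ t)))
               := M :* ρ :* G :* ((s :+ ρ) :^ 2 :+ (t :+ ρ :^ 2))) refl ρ M G s t ⟩
        M * ρ * G * ((s + ρ) ^ 2 + (t + ρ ^ 2)) ∎
    }
    where
    ρ = r (suc m)
    M = suc m × 1#
    G = residue r m
    s = ∑< (suc m) r
    t = ∑< (suc m) (λ i → r i ^ 2)
    ih = reciprocal-moments m (λ i i≤m → zr≈1 i (ℕ.m≤n⇒m≤1+n i≤m))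
    step : ∀ k → Δ (suc m) (λ i → 1# * r i ^ suc k) ≈
      ρ * (Δ (suc m) (λ i → 1# * r i ^ k) + M * Δ m (λ i → 1# * r i ^ suc k))
    step k = Δ-quotient m (zr≈1 (suc m) ℕ.≤-refl) λ i i≤ → begin
      (z + i × 1#) * (1# * (r i * r i ^ k))
        ≈⟨ solve 3 (λ a r v → a :* (𝟙 :* (r :* v)) := a :* r :* v) refl (z + i × 1#) (r i) (r i ^ k) ⟩
      (z + i × 1#) * r i * r i ^ k
        ≈⟨ *-congʳ (zr≈1 i i≤) ⟩
      1# * r i ^ k ∎
    first′ : Δ (suc m) (λ i → 1# * r i ^ 1) ≈ M * ρ * G
    first′ = begin
      Δ (suc m) (λ i → 1# * r i ^ 1)
        ≈⟨ step 0 ⟩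
      ρ * (Δ (suc m) (λ i → 1# * 1#) + M * Δ m (λ i → 1# * r i ^ 1))
        -- For the first power the numerator left by the division is constant, and a difference of
        -- positive order annihilates it.
        ≈⟨ *-congˡ (+-cong (Degree≤-const (1# * 1#) (suc m) (s≤s z≤n)) (*-congˡ (Moments.first ih))) ⟩
      ρ * (0# + M * G)
        ≈⟨ solve 3 (λ ρ M G → ρ :* (𝟘 :+ M :* G) := M :* ρ :* G) refl ρ M G ⟩
      M * ρ * G ∎
    second′ : Δ (suc m) (λ i → 1# * r i ^ 2) ≈ M * ρ * G * (s + ρ)
    second′ = begin
      Δ (suc m) (λ i → 1# * r i ^ 2)
        ≈⟨ step 1 ⟩
      ρ * (Δ (suc m) (λ i → 1# * r i ^ 1) + M * Δ m (λ i → 1# * r i ^ 2))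
        ≈⟨ *-congˡ (+-cong first′ (*-congˡ (Moments.second ih))) ⟩
      ρ * (M * ρ * G + M * (G * s))
        ≈⟨ solve 4 (λ ρ M G s → ρ :* (M :* ρ :* G :+ M :* (G :* s)) := M :* ρ :* G :* (s :+ ρ)) refl ρ M G s ⟩
      M * ρ * G * (s + ρ) ∎

  module _ {m z r} (zr≈1 : Reciprocals m z r) where
    Δ-linear* : ∀ b (h : ℕ → Carrier) k → Δ m (λ i → (b + i × 1#) * h i * r i ^ suc k) ≈
      Δ m (λ i → h i * r i ^ k) + (b - z) * Δ m (λ i → h i * r i ^ suc k)
    Δ-linear* b h k = begin
      Δ m (λ i → (b + i × 1#) * h i * r i ^ suc k)
        ≈⟨ Δ-cong m (λ i i≤m → begin
             (b + i × 1#) * h i * (r i * r i ^ k)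
               ≈⟨ solve 6 (λ b z i h r v → (b :+ i) :* h :* (r :* v)
                    := (z :+ i) :* r :* (h :* v) :+ (b :- z) :* (h :* (r :* v))) refl
                    b z (i × 1#) (h i) (r i) (r i ^ k) ⟩
             (z + i × 1#) * r i * (h i * r i ^ k) + (b - z) * (h i * (r i * r i ^ k))
               ≈⟨ +-congʳ (trans (*-congʳ (zr≈1 i i≤m)) (*-identityˡ _)) ⟩
             h i * r i ^ k + (b - z) * (h i * (r i * r i ^ k)) ∎) ⟩
      Δ m (λ i → h i * r i ^ k + (b - z) * (h i * r i ^ suc k))
        ≈⟨ trans (Δ-+ m _ _) (+-congˡ (Δ-*ˡ m (b - z) _)) ⟩
      Δ m (λ i → h i * r i ^ k) + (b - z) * Δ m (λ i → h i * r i ^ suc k) ∎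

    -- The generating function is multiplied by `b - z + ε`, whose logarithmic derivative at 0 is
    -- `w`, with derivative `- w ^ 2`. This case is separate for the sake of the last factor in
    -- `residue-sum`, where `h` has degree `m` and `Δ m h` may be nonzero.
    third-linear* : ∀ b {w h q s t} → (b - z) * w ≈ 1# → Moments m r h q s t →
      (1# + 1#) * Δ m (λ i → (b + i × 1#) * h i * r i ^ 3) ≈
      (b - z) * q * ((s + w) ^ 2 + (t - w ^ 2))
    third-linear* b {w} {h} {q} {s} {t} βw≈1 μ = begin
      (1# + 1#) * Δ m (λ i → (b + i × 1#) * h i * r i ^ 3)
        ≈⟨ *-congˡ (Δ-linear* b h 2) ⟩
      (1# + 1#) * (Δ m (λ i → h i * r i ^ 2) + (b - z) * Δ m (λ i → h i * r i ^ 3))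
        ≈⟨ *-congˡ (+-congʳ (trans (Moments.second μ) (trans (sym (*-identityˡ _)) (*-congʳ (sym βw≈1))))) ⟩
      (1# + 1#) * ((b - z) * w * (q * s) + (b - z) * Δ m (λ i → h i * r i ^ 3))
        ≈⟨ solve 5 (λ β w q s v → (𝟙 :+ 𝟙) :* (β :* w :* (q :* s) :+ β :* v)
             := (𝟙 :+ 𝟙) :* (β :* w :* (q :* s)) :+ β :* ((𝟙 :+ 𝟙) :* v)) refl
             (b - z) w q s (Δ m (λ i → h i * r i ^ 3)) ⟩
      (1# + 1#) * ((b - z) * w * (q * s)) + (b - z) * ((1# + 1#) * Δ m (λ i → h i * r i ^ 3))
        ≈⟨ +-congˡ (*-congˡ (Moments.third μ)) ⟩
      (1# + 1#) * ((b - z) * w * (q * s)) + (b - z) * (q * (s ^ 2 + t))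
        ≈⟨ solve 5 (λ β w q s t → (𝟙 :+ 𝟙) :* (β :* w :* (q :* s)) :+ β :* (q :* (s :^ 2 :+ t))
             := β :* q :* ((s :+ w) :^ 2 :+ (t :- w :^ 2))) refl (b - z) w q s t ⟩
      (b - z) * q * ((s + w) ^ 2 + (t - w ^ 2)) ∎

    -- Since `(b+i)/(z+i-ε) = 1 + (b-z+ε)/(z+i-ε)`, the generating function is multiplied by
    -- `b - z + ε` up to the constant `Δ m h`. That constant enters `first` alone, and it vanishes
    -- as long as the degree of `h` is below `m`.
    linear*-moments : ∀ b {w h q s t} → (b - z) * w ≈ 1# → Δ m h ≈ 0# → Moments m r h q s t →
      Moments m r (λ i → (b + i × 1#) * h i) ((b - z) * q) (s + w) (t - w ^ 2)
    linear*-moments b {w} {h} {q} {s} {t} βw≈1 Δh≈0 μ = record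
      { first  = begin
          Δ m (λ i → (b + i × 1#) * h i * r i ^ 1)
            ≈⟨ Δ-linear* b h 0 ⟩
          Δ m (λ i → h i * 1#) + (b - z) * Δ m (λ i → h i * r i ^ 1)
            ≈⟨ +-cong (trans (Δ-cong m λ i _ → *-identityʳ (h i)) Δh≈0) (*-congˡ (Moments.first μ)) ⟩
          0# + (b - z) * q
            ≈⟨ +-identityˡ _ ⟩
          (b - z) * q ∎
      ; second = begin
          Δ m (λ i → (b + i × 1#) * h i * r i ^ 2)
            ≈⟨ Δ-linear* b h 1 ⟩
          Δ m (λ i → h i * r i ^ 1) + (b - z) * Δ m (λ i → h i * r i ^ 2)
            ≈⟨ +-cong (trans (Moments.first μ) (trans (sym (*-identityˡ _)) (*-congʳ (sym βw≈1))))
                      (*-congˡ (Moments.second μ)) ⟩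
          (b - z) * w * q + (b - z) * (q * s)
            ≈⟨ solve 4 (λ β w q s → β :* w :* q :+ β :* (q :* s) := β :* q :* (s :+ w)) refl (b - z) w q s ⟩
          (b - z) * q * (s + w) ∎
      ; third  = third-linear* b βw≈1 μ
      }

    Moments-cong : ∀ {h h′ q q′ s s′ t t′} → (∀ i → h i ≈ h′ i) → q ≈ q′ → s ≈ s′ → t ≈ t′ →
      Moments m r h q s t → Moments m r h′ q′ s′ t′
    Moments-cong h≈ q≈ s≈ t≈ μ = record
      { first  = trans (Δ-cong m λ i _ → *-congʳ (sym (h≈ i))) (trans (Moments.first μ) q≈)
      ; second = trans (Δ-cong m λ i _ → *-congʳ (sym (h≈ i))) (trans (Moments.second μ) (*-cong q≈ s≈))
      ; third  = trans (*-congˡ (Δ-cong m λ i _ → *-congʳ (sym (h≈ i)))) (trans (Moments.third μ)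
          (*-cong q≈ (+-cong (*-cong s≈ (*-congʳ s≈)) t≈)))
      }

-- The identity over a Heyting field of characteristic zero.

module HarmonicSums {c ℓ₁ ℓ₂} (F : HeytingField c ℓ₁ ℓ₂) (char0 : CharacteristicZero F) where
  open HeytingField F using (heytingCommutativeRing; _#_; #⇒invertible)
  open FieldCalculus F char0
  open CommutativeRing (HeytingCommutativeRing.commutativeRing heytingCommutativeRing)
  private
    R = HeytingCommutativeRing.commutativeRing heytingCommutativeRing
  open Algebra.Apartness.Properties.HeytingCommutativeRing heytingCommutativeRing using (x-0≈x)
  open Algebra.Properties.Semiring.Exp semiring using (^-congˡ)
  open Algebra.Properties.CommutativeSemiring.Exp commutativeSemiring using (^-distrib-*)
  open Algebra.Properties.Semiring.Mult semiring using (×1-homo-*)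
  open Algebra.Properties.Semiring.Sum semiring using (*-distribʳ-sum)
  open IntegerRingSolver R
  open AlternatingSums R
  open Relation.Binary.Reasoning.Setoid setoid

  -- Falling factorials.

  falling-cong : ∀ {u v} k → u ≈ v → falling u k ≈ falling v k
  falling-cong zero    u≈v = refl
  falling-cong (suc k) u≈v = *-cong (falling-cong k u≈v) (+-congʳ u≈v)

  falling-suc : ∀ u k → falling u (suc k) ≈ u * falling (u - 1#) k
  falling-suc u zero    = solve 1 (λ u → 𝟙 :* (u :- 𝟘) := u :* 𝟙) refl u
  falling-suc u (suc k) = trans (*-congʳ (falling-suc u k))
    (solve 3 (λ u f k → u :* f :* (u :- (𝟙 :+ k)) := u :* (f :* (u :- 𝟙 :- k))) refl
      u (falling (u - 1#) k) (fromℕ k))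

  falling-+ : ∀ u j k → falling u (j ℕ.+ k) ≈ falling u j * falling (u - fromℕ j) k
  falling-+ u zero    k = trans (falling-cong k (solve 1 (λ u → u := u :- 𝟘) refl u)) (sym (*-identityˡ _))
  falling-+ u (suc j) k = begin
    falling u (suc (j ℕ.+ k))
      ≈⟨ falling-suc u (j ℕ.+ k) ⟩
    u * falling (u - 1#) (j ℕ.+ k)
      ≈⟨ *-congˡ (falling-+ (u - 1#) j k) ⟩
    u * (falling (u - 1#) j * falling (u - 1# - fromℕ j) k)
      ≈⟨ *-assoc _ _ _ ⟨
    u * falling (u - 1#) j * falling (u - 1# - fromℕ j) k
      ≈⟨ *-cong (sym (falling-suc u j))
           (falling-cong k (solve 2 (λ u j → u :- 𝟙 :- j := u :- (𝟙 :+ j)) refl u (fromℕ j))) ⟩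
    falling u (suc j) * falling (u - fromℕ (suc j)) k ∎

  falling-pascal : ∀ u k → falling (1# + u) (suc k) ≈ falling u (suc k) + fromℕ (suc k) * falling u k
  falling-pascal u k = begin
    falling (1# + u) (suc k)
      ≈⟨ falling-suc (1# + u) k ⟩
    (1# + u) * falling (1# + u - 1#) k
      ≈⟨ *-congˡ (falling-cong k (solve 1 (λ u → 𝟙 :+ u :- 𝟙 := u) refl u)) ⟩
    (1# + u) * falling u k
      ≈⟨ solve 3 (λ u f k → (𝟙 :+ u) :* f := f :* (u :- k) :+ (𝟙 :+ k) :* f) refl u (falling u k) (fromℕ k) ⟩
    falling u (suc k) + fromℕ (suc k) * falling u k ∎

  -- Negating the factors `a + d`, ..., `a + 1` and reversing their order gives `- a - 1`, ...,
  -- `- a - d`. Hence the induction removes the first factor on the left and the last one on the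
  -- right.
  falling-reflect : ∀ a d → falling (a + fromℕ d) d ≈ (- 1#) ^ d * falling (- a - 1#) d
  falling-reflect a zero    = sym (*-identityˡ 1#)
  falling-reflect a (suc d) = begin
    falling (a + fromℕ (suc d)) (suc d)
      ≈⟨ falling-suc (a + fromℕ (suc d)) d ⟩
    (a + fromℕ (suc d)) * falling (a + fromℕ (suc d) - 1#) d
      ≈⟨ *-congˡ (falling-cong d (solve 2 (λ a d → a :+ (𝟙 :+ d) :- 𝟙 := a :+ d) refl a (fromℕ d))) ⟩
    (a + fromℕ (suc d)) * falling (a + fromℕ d) d
      ≈⟨ *-congˡ (falling-reflect a d) ⟩
    (a + fromℕ (suc d)) * ((- 1#) ^ d * falling (- a - 1#) d)
      ≈⟨ solve 4 (λ a d σ f → (a :+ (𝟙 :+ d)) :* (σ :* f) := (:- 𝟙) :* σ :* (f :* (:- a :- 𝟙 :- d))) refl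
           a (fromℕ d) ((- 1#) ^ d) (falling (- a - 1#) d) ⟩
    (- 1#) ^ suc d * falling (- a - 1#) (suc d) ∎

  sign-square : ∀ k → (- 1#) ^ k * (- 1#) ^ k ≈ 1#
  sign-square zero    = *-identityˡ 1#
  sign-square (suc k) = trans
    (solve 1 (λ σ → (:- 𝟙) :* σ :* ((:- 𝟙) :* σ) := σ :* σ) refl ((- 1#) ^ k)) (sign-square k)

  -- Reciprocals and cancellation.

  inv : ∀ {d} → d # 0# → Carrier
  inv d#0 = proj₁ (#⇒invertible d#0)

  inverse : ∀ {d} (d#0 : d # 0#) → d * inv d#0 ≈ 1#
  inverse {d} d#0 = trans (*-congʳ (sym (x-0≈x d))) (proj₂ (proj₂ (#⇒invertible d#0)))

  inverse-unique : ∀ {d a b} → d * a ≈ 1# → d * b ≈ 1# → a ≈ b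
  inverse-unique {d} {a} {b} da≈1 db≈1 = begin
    a            ≈⟨ *-identityʳ a ⟨
    a * 1#       ≈⟨ *-congˡ db≈1 ⟨
    a * (d * b)  ≈⟨ solve 3 (λ a d b → a :* (d :* b) := d :* a :* b) refl a d b ⟩
    d * a * b    ≈⟨ *-congʳ da≈1 ⟩
    1# * b       ≈⟨ *-identityˡ b ⟩
    b            ∎

  *-cancelʳ : ∀ {a b d d⁻¹} → d * d⁻¹ ≈ 1# → a * d ≈ b * d → a ≈ b
  *-cancelʳ {a} {b} {d} {d⁻¹} dd⁻¹≈1 ad≈bd = begin
    a              ≈⟨ *-identityʳ a ⟨
    a * 1#         ≈⟨ *-congˡ dd⁻¹≈1 ⟨
    a * (d * d⁻¹)  ≈⟨ *-assoc _ _ _ ⟨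
    a * d * d⁻¹    ≈⟨ *-congʳ ad≈bd ⟩
    b * d * d⁻¹    ≈⟨ *-assoc _ _ _ ⟩
    b * (d * d⁻¹)  ≈⟨ *-congˡ dd⁻¹≈1 ⟩
    b * 1#         ≈⟨ *-identityʳ b ⟩
    b              ∎

  -- Binomial coefficients and signed binomial sums.

  fact⁻¹ : ℕ → Carrier
  fact⁻¹ k = inv (fromℕ#0 (k ℕ.!) {{k ℕ.!≢0}})

  fact-inverse : ∀ k → fromℕ (k ℕ.!) * fact⁻¹ k ≈ 1#
  fact-inverse k = inverse (fromℕ#0 (k ℕ.!) {{k ℕ.!≢0}})

  fact⁻¹-suc : ∀ k → fromℕ (suc k) * fact⁻¹ (suc k) ≈ fact⁻¹ k
  fact⁻¹-suc k = inverse-unique (begin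
    fromℕ (k ℕ.!) * (fromℕ (suc k) * fact⁻¹ (suc k))
      ≈⟨ solve 3 (λ a b c → a :* (b :* c) := b :* a :* c) refl _ _ _ ⟩
    fromℕ (suc k) * fromℕ (k ℕ.!) * fact⁻¹ (suc k)
      ≈⟨ *-congʳ (×1-homo-* (suc k) (k ℕ.!)) ⟨
    fromℕ (suc k ℕ.!) * fact⁻¹ (suc k)
      ≈⟨ fact-inverse (suc k) ⟩
    1# ∎) (fact-inverse k)

  binom-zero : ∀ u → binom u 0 ≈ 1#
  binom-zero u = trans (*-congʳ (sym (+-identityʳ 1#))) (fact-inverse 0)

  binom-pascal : ∀ n k → binom (fromℕ (suc n)) (suc k) ≈ binom (fromℕ n) (suc k) + binom (fromℕ n) k
  binom-pascal n k = begin
    falling (fromℕ (suc n)) (suc k) * fact⁻¹ (suc k)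
      ≈⟨ *-congʳ (falling-pascal (fromℕ n) k) ⟩
    (falling (fromℕ n) (suc k) + fromℕ (suc k) * falling (fromℕ n) k) * fact⁻¹ (suc k)
      ≈⟨ solve 4 (λ a b c d → (a :+ b :* c) :* d := a :* d :+ c :* (b :* d)) refl _ _ _ _ ⟩
    binom (fromℕ n) (suc k) + falling (fromℕ n) k * (fromℕ (suc k) * fact⁻¹ (suc k))
      ≈⟨ +-congˡ (*-congˡ (fact⁻¹-suc k)) ⟩
    binom (fromℕ n) (suc k) + binom (fromℕ n) k ∎

  binom-vanishes : ∀ n → binom (fromℕ n) (suc n) ≈ 0#
  binom-vanishes n = trans (*-congʳ (*-congˡ (-‿inverseʳ (fromℕ n))))
    (solve 2 (λ a b → a :* 𝟘 :* b := 𝟘) refl _ _)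

  signed-binom : ℕ → ℕ → Carrier
  signed-binom n k = (- 1#) ^ k * binom (fromℕ n) k

  -- Pascal's rule on partial sums: the second sum has one term fewer because its index is shifted.
  -- At full length the extra term of the first sum carries `binom (fromℕ n) (suc n)`, which is
  -- zero, and the recursion of `Δ` appears.
  ∑<-signed-binom-suc : ∀ n (f : ℕ → Carrier) k → ∑< (suc k) (λ i → signed-binom (suc n) i * f i) ≈
    ∑< (suc k) (λ i → signed-binom n i * f i) - ∑< k (λ i → signed-binom n i * f (suc i))
  ∑<-signed-binom-suc n f zero    =
    solve 1 (λ a → 𝟘 :+ a := (𝟘 :+ a) :- 𝟘) refl (signed-binom n 0 * f 0)
  ∑<-signed-binom-suc n f (suc k) = begin
    ∑< (suc k) (λ i → signed-binom (suc n) i * f i) + signed-binom (suc n) (suc k) * f (suc k)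
      ≈⟨ +-cong (∑<-signed-binom-suc n f k) (*-congʳ (*-congˡ (binom-pascal n k))) ⟩
    a - b + (- 1#) ^ suc k * (binom (fromℕ n) (suc k) + binom (fromℕ n) k) * f (suc k)
      ≈⟨ solve 6 (λ a b σ p p′ v → a :- b :+ (:- 𝟙) :* σ :* (p′ :+ p) :* v
           := (a :+ (:- 𝟙) :* σ :* p′ :* v) :- (b :+ σ :* p :* v)) refl
           a b ((- 1#) ^ k) (binom (fromℕ n) k) (binom (fromℕ n) (suc k)) (f (suc k)) ⟩
    (a + signed-binom n (suc k) * f (suc k)) - (b + signed-binom n k * f (suc k)) ∎
    where
    a = ∑< (suc k) (λ i → signed-binom n i * f i)
    b = ∑< k (λ i → signed-binom n i * f (suc i))

  ∑<-signed-binom : ∀ n (f : ℕ → Carrier) → ∑< (suc n) (λ i → signed-binom n i * f i) ≈ Δ n f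
  ∑<-signed-binom zero    f = trans (+-congˡ (*-congʳ (*-congˡ (binom-zero 0#))))
    (solve 1 (λ a → 𝟘 :+ 𝟙 :* 𝟙 :* a := a) refl (f 0))
  ∑<-signed-binom (suc n) f = begin
    ∑< (2 ℕ.+ n) (λ i → signed-binom (suc n) i * f i)
      ≈⟨ ∑<-signed-binom-suc n f (suc n) ⟩
    ∑< (suc n) (λ i → signed-binom n i * f i) + signed-binom n (suc n) * f (suc n)
      - ∑< (suc n) (λ i → signed-binom n i * f (suc i))
      ≈⟨ +-cong (+-cong (∑<-signed-binom n f) (*-congʳ (*-congˡ (binom-vanishes n))))
                (-‿cong (∑<-signed-binom n (λ i → f (suc i)))) ⟩
    Δ n f + (- 1#) ^ suc n * 0# * f (suc n) - Δ n (λ i → f (suc i))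
      ≈⟨ +-congʳ (solve 3 (λ a σ v → a :+ σ :* 𝟘 :* v := a) refl _ _ _) ⟩
    Δ (suc n) f ∎

  sum-upTo≈∑< : ∀ n {f} g → (∀ k k≤n → f k k≤n ≈ g k) → sum-upTo n f ≈ ∑< (suc n) g
  sum-upTo≈∑< n g f≈g = sum≈∑< {suc n} _ g (λ i → f≈g (toℕ i) (Fin.toℕ≤pred[n] i))

  -- Harmonic numbers as partial sums of one sequence of reciprocals.

  -- The junk value 0 is taken outside the range where u + (i + 1) is known to be invertible.
  recip : ∀ {n u} → NoPole u n → ℕ → Carrier
  recip {n} h i with i ℕ.<? n
  ... | yes i<n = inv (x#-y⇒x+y#0 (h (suc i) (s≤s z≤n) i<n))
  ... | no  _   = 0#

  recip-inverse : ∀ {n u} (h : NoPole u n) i → i ℕ.< n → (u + fromℕ (suc i)) * recip h i ≈ 1#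
  recip-inverse {n} h i i<n with i ℕ.<? n
  ... | yes i<n′ = inverse (x#-y⇒x+y#0 (h (suc i) (s≤s z≤n) i<n′))
  ... | no  i≮n  = contradiction i<n i≮n

  1^ : ∀ ℓ → 1# ^ ℓ ≈ 1#
  1^ zero    = refl
  1^ (suc ℓ) = trans (*-identityˡ _) (1^ ℓ)

  -- The sequence depends only on the proof `h` for the full range `n`. Thus the harmonic numbers of
  -- all lengths `k ≤ n`, each with its own proof `h′`, become partial sums of the same sequence;
  -- uniqueness of inverses makes the choice of proof immaterial.
  H≈∑<recip : ∀ ℓ {n u k} (h : NoPole u n) (h′ : NoPole u k) → k ℕ.≤ n →
    H ℓ k u h′ ≈ ∑< k (λ i → recip h i ^ ℓ)
  H≈∑<recip ℓ {n} {u} {k} h h′ k≤n = sum≈∑< _ _ λ i → trans (*-identityˡ _)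
    (inverse-unique (inverse (x^n#0 ℓ _)) (begin
      (u + fromℕ (suc (toℕ i))) ^ ℓ * recip h (toℕ i) ^ ℓ
        ≈⟨ ^-distrib-* _ _ ℓ ⟨
      ((u + fromℕ (suc (toℕ i))) * recip h (toℕ i)) ^ ℓ
        ≈⟨ ^-congˡ ℓ (recip-inverse h (toℕ i) (ℕ.<-≤-trans (Fin.toℕ<n i) k≤n)) ⟩
      1# ^ ℓ
        ≈⟨ 1^ ℓ ⟩
      1# ∎))

  -- Moments and Gosper summation for falling factorials.

  Degree≤-falling : ∀ v d → Degree≤ d (λ i → falling (fromℕ i + v) d)
  Degree≤-falling v zero    = Degree≤-const 1#
  Degree≤-falling v (suc d) m d<m = trans
    (Δ-cong m λ i _ → solve 4 (λ f i v d → f :* (i :+ v :- d) := (v :- d :+ i) :* f) refl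
      (falling (fromℕ i + v) d) (fromℕ i) v (fromℕ d))
    (Degree≤-linear* (v - fromℕ d) (Degree≤-falling v d) m d<m)

  -- The factors `v - t + i` are multiplied on one at a time. Before each multiplication the product
  -- has degree `d` below `m`, which is what `linear*-moments` requires.
  falling-moments : ∀ {m z r} → Reciprocals m z r → ∀ v w d → d ℕ.≤ m →
    (∀ t → t ℕ.< d → (v - fromℕ t - z) * w t ≈ 1#) →
    Moments m r (λ i → falling (fromℕ i + v) d) (falling (v - z) d * residue r m)
      (∑< (suc m) r + ∑< d w) (∑< (suc m) (λ i → r i ^ 2) - ∑< d (λ i → w i ^ 2))
  falling-moments {m} zr≈1 v w zero    d≤m vw≈1 = Moments-cong zr≈1 (λ _ → refl)
    (sym (*-identityˡ _)) (sym (+-identityʳ _)) (sym (x-0≈x _)) (reciprocal-moments m zr≈1)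
  falling-moments {m} {z} {r} zr≈1 v w (suc d) d<m vw≈1 = Moments-cong zr≈1
    (λ i → solve 4 (λ f i v d → (v :- d :+ i) :* f := f :* (i :+ v :- d)) refl
      (falling (fromℕ i + v) d) (fromℕ i) v (fromℕ d))
    (solve 5 (λ v d z f G → (v :- d :- z) :* (f :* G) := f :* (v :- z :- d) :* G) refl
      v (fromℕ d) z (falling (v - z) d) (residue r m))
    (+-assoc _ _ _)
    (solve 3 (λ a b c → a :- b :- c := a :- (b :+ c)) refl _ _ _)
    (linear*-moments zr≈1 (v - fromℕ d) (vw≈1 d ℕ.≤-refl) (Degree≤-falling v d m d<m)
      (falling-moments zr≈1 v w d (ℕ.<⇒≤ d<m) (λ t t<d → vw≈1 t (ℕ.m<n⇒m<1+n t<d))))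

  residue*falling : ∀ m {z r} → Reciprocals m z r →
    residue r m * falling (z + fromℕ m) (suc m) ≈ fromℕ (m ℕ.!)
  residue*falling zero    {z} {r} zr≈1 = begin
    r 0 * (1# * (z + 0# - 0#))  ≈⟨ solve 2 (λ r z → r :* (𝟙 :* (z :+ 𝟘 :- 𝟘)) := (z :+ 𝟘) :* r :+ 𝟘) refl (r 0) z ⟩
    (z + 0#) * r 0 + 0#         ≈⟨ +-congʳ (zr≈1 0 z≤n) ⟩
    1# + 0#                     ∎
  residue*falling (suc m) {z} {r} zr≈1 = begin
    M * ρ * G * falling (z + M) (2 ℕ.+ m)
      ≈⟨ *-congˡ (falling-suc (z + M) (suc m)) ⟩
    M * ρ * G * ((z + M) * falling (z + M - 1#) (suc m))
      ≈⟨ *-congˡ (*-congˡ (falling-cong (suc m)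
           (solve 2 (λ z m → z :+ (𝟙 :+ m) :- 𝟙 := z :+ m) refl z (fromℕ m)))) ⟩
    M * ρ * G * ((z + M) * falling (z + fromℕ m) (suc m))
      ≈⟨ solve 5 (λ M ρ G a f → M :* ρ :* G :* (a :* f) := a :* ρ :* (M :* (G :* f))) refl _ _ _ _ _ ⟩
    (z + M) * ρ * (M * (G * falling (z + fromℕ m) (suc m)))
      ≈⟨ *-cong (zr≈1 (suc m) ℕ.≤-refl)
           (*-congˡ (residue*falling m (λ i i≤m → zr≈1 i (ℕ.m≤n⇒m≤1+n i≤m)))) ⟩
    1# * (M * fromℕ (m ℕ.!))
      ≈⟨ *-identityˡ _ ⟩
    M * fromℕ (m ℕ.!)
      ≈⟨ ×1-homo-* (suc m) (m ℕ.!) ⟨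
    fromℕ (suc m ℕ.!) ∎
    where
    M = fromℕ (suc m)
    ρ = r (suc m)
    G = residue r m

  -- In `Δ-gosper` for `g = q f`, the factor `y - M + i` completes `q (suc i)` at its lower end and
  -- `y - 1 + i` completes `q i` at its upper end. Both become the same `P i`, so the two sums merge
  -- into one over increments of `f`: this is the summation by parts.
  falling-gosper : ∀ m y (f : ℕ → Carrier) → let M = fromℕ (suc m) in
    M * (y * (y - 1#)) * Δ (2 ℕ.+ m) (λ k → falling (fromℕ k + (y - 1# - 1#)) m * f k) ≈
    Δ (suc m) (λ i → (- (M * y) + fromℕ i) * falling (fromℕ i + (y - 1#)) (suc m) * (f (suc i) - f i))
  falling-gosper m y f = begin
    M * (y * (y - 1#)) * Δ (2 ℕ.+ m) g
      ≈⟨ Δ-gosper m y g ⟩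
    Δ (suc m) (λ i → (- (M * y) + fromℕ i) * ((y - M + fromℕ i) * g (suc i)))
      - Δ (suc m) (λ i → (- (M * y) + fromℕ i) * ((y - 1# + fromℕ i) * g i))
      ≈⟨ Δ-- (suc m) _ _ ⟨
    Δ (suc m) (λ i → (- (M * y) + fromℕ i) * ((y - M + fromℕ i) * g (suc i))
      - (- (M * y) + fromℕ i) * ((y - 1# + fromℕ i) * g i))
      ≈⟨ Δ-cong (suc m) (λ i _ → begin
           (- (M * y) + fromℕ i) * ((y - M + fromℕ i) * (q (suc i) * f (suc i)))
             - (- (M * y) + fromℕ i) * ((y - 1# + fromℕ i) * (q i * f i))
             ≈⟨ solve 7 (λ a b c p p′ v v′ → a :* (b :* (p′ :* v′)) :- a :* (c :* (p :* v))
                  := a :* (b :* p′) :* v′ :- a :* (c :* p) :* v) refl _ _ _ _ _ _ _ ⟩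
           (- (M * y) + fromℕ i) * ((y - M + fromℕ i) * q (suc i)) * f (suc i)
             - (- (M * y) + fromℕ i) * ((y - 1# + fromℕ i) * q i) * f i
             ≈⟨ +-cong (*-congʳ (*-congˡ (shift i))) (-‿cong (*-congʳ (*-congˡ (extend i)))) ⟩
           (- (M * y) + fromℕ i) * P i * f (suc i) - (- (M * y) + fromℕ i) * P i * f i
             ≈⟨ solve 4 (λ a p v v′ → a :* p :* v′ :- a :* p :* v := a :* p :* (v′ :- v)) refl _ _ _ _ ⟩
           (- (M * y) + fromℕ i) * P i * (f (suc i) - f i) ∎) ⟩
    Δ (suc m) (λ i → (- (M * y) + fromℕ i) * P i * (f (suc i) - f i)) ∎
    where
    M = fromℕ (suc m)
    q P g : ℕ → Carrier
    q k = falling (fromℕ k + (y - 1# - 1#)) m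
    P k = falling (fromℕ k + (y - 1#)) (suc m)
    g k = q k * f k
    shift : ∀ i → (y - M + fromℕ i) * q (suc i) ≈ P i
    shift i = begin
      (y - M + fromℕ i) * q (suc i)
        ≈⟨ *-congˡ (falling-cong m (solve 2 (λ i y → 𝟙 :+ i :+ (y :- 𝟙 :- 𝟙) := i :+ (y :- 𝟙)) refl (fromℕ i) y)) ⟩
      (y - M + fromℕ i) * falling (fromℕ i + (y - 1#)) m
        ≈⟨ solve 4 (λ y m i f → (y :- (𝟙 :+ m) :+ i) :* f := f :* (i :+ (y :- 𝟙) :- m)) refl
             y (fromℕ m) (fromℕ i) (falling (fromℕ i + (y - 1#)) m) ⟩
      P i ∎
    extend : ∀ i → (y - 1# + fromℕ i) * q i ≈ P i
    extend i = begin
      (y - 1# + fromℕ i) * q i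
        ≈⟨ *-cong (+-comm _ _) (falling-cong m (sym (+-assoc _ _ _))) ⟩
      (fromℕ i + (y - 1#)) * falling (fromℕ i + (y - 1#) - 1#) m
        ≈⟨ falling-suc (fromℕ i + (y - 1#)) m ⟨
      P i ∎

  sum-upTo-*ʳ : ∀ n (f : ∀ k → k ℕ.≤ n → Carrier) a → sum-upTo n f * a ≈ sum-upTo n (λ k k≤n → f k k≤n * a)
  sum-upTo-*ʳ n f a = *-distribʳ-sum {suc n} a (λ i → f (toℕ i) (Fin.toℕ≤pred[n] i))

  -- Identifies the coefficient as `q(k) / q(0)` with `q` of degree `n - 2`. The value `q(0)` is
  -- moved to the other side and `i₁`, `i₂` stand for reciprocals, so that only products have to be
  -- compared.
  weight : ∀ {y n k i₁ i₂} → 2 ℕ.≤ n → k ℕ.≤ n →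
    binom (y - fromℕ n + fromℕ k) k * i₁ ≈ 1# →
    (y + fromℕ k - 1#) * (y + fromℕ k) * i₂ ≈ 1# →
    binom (y + fromℕ k) k * i₁ * ((y - 1#) * y * i₂) * falling (y - 1# - 1#) (n ℕ.∸ 2) ≈
    falling (fromℕ k + (y - 1# - 1#)) (n ℕ.∸ 2)
  weight {y} {suc (suc m)} {k} {i₁} {i₂} (s≤s (s≤s z≤n)) k≤n inv₁ inv₂ = begin
    F₁ * j * i₁ * ((y - 1#) * y * i₂) * q₀
      ≈⟨ solve 6 (λ F₁ j i₁ y i₂ q₀ → F₁ :* j :* i₁ :* ((y :- 𝟙) :* y :* i₂) :* q₀
           := F₁ :* (y :* (y :- 𝟙) :* q₀) :* (j :* i₁ :* i₂)) refl F₁ j i₁ y i₂ q₀ ⟩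
    F₁ * (y * (y - 1#) * q₀) * (j * i₁ * i₂)
      ≈⟨ *-congʳ (*-congˡ (falling-split y)) ⟨
    F₁ * falling y (2 ℕ.+ m) * (j * i₁ * i₂)
      ≈⟨ *-congʳ exchange ⟩
    (y + K) * (y + K - 1#) * qₖ * F₂ * (j * i₁ * i₂)
      ≈⟨ solve 7 (λ a b qₖ F₂ j i₁ i₂ → a :* b :* qₖ :* F₂ :* (j :* i₁ :* i₂)
           := b :* a :* i₂ :* (F₂ :* j :* i₁) :* qₖ) refl (y + K) (y + K - 1#) qₖ F₂ j i₁ i₂ ⟩
    (y + K - 1#) * (y + K) * i₂ * (F₂ * j * i₁) * qₖ
      ≈⟨ *-congʳ (*-cong inv₂ inv₁) ⟩
    1# * 1# * qₖ
      ≈⟨ solve 1 (λ q → 𝟙 :* 𝟙 :* q := q) refl qₖ ⟩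
    qₖ ∎
    where
    K = fromℕ k
    j = fact⁻¹ k
    F₁ = falling (y + K) k
    F₂ = falling (y - fromℕ (2 ℕ.+ m) + K) k
    q₀ = falling (y - 1# - 1#) m
    qₖ = falling (K + (y - 1# - 1#)) m
    falling-split : ∀ u → falling u (2 ℕ.+ m) ≈ u * (u - 1#) * falling (u - 1# - 1#) m
    falling-split u = trans (falling-suc u (suc m))
      (trans (*-congˡ (falling-suc (u - 1#) m)) (sym (*-assoc _ _ _)))
    -- Both sides are the falling factorial of y + k of length n + k.
    exchange : F₁ * falling y (2 ℕ.+ m) ≈ (y + K) * (y + K - 1#) * qₖ * F₂
    exchange = begin
      F₁ * falling y (2 ℕ.+ m)
        ≈⟨ *-congˡ (falling-cong (2 ℕ.+ m) (solve 2 (λ y K → y := y :+ K :- K) refl y K)) ⟩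
      F₁ * falling (y + K - K) (2 ℕ.+ m)
        ≈⟨ falling-+ (y + K) k (2 ℕ.+ m) ⟨
      falling (y + K) (k ℕ.+ (2 ℕ.+ m))
        ≡⟨ ≡.cong (falling (y + K)) (ℕ.+-comm k (2 ℕ.+ m)) ⟩
      falling (y + K) (2 ℕ.+ m ℕ.+ k)
        ≈⟨ falling-+ (y + K) (2 ℕ.+ m) k ⟩
      falling (y + K) (2 ℕ.+ m) * falling (y + K - fromℕ (2 ℕ.+ m)) k
        ≈⟨ *-cong (falling-split (y + K))
             (falling-cong k (solve 3 (λ y K n → y :+ K :- n := y :- n :+ K) refl y K (fromℕ (2 ℕ.+ m)))) ⟩
      (y + K) * (y + K - 1#) * falling (y + K - 1# - 1#) m * F₂
        ≈⟨ *-congʳ (*-congˡ (falling-cong m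
             (solve 2 (λ y K → y :+ K :- 𝟙 :- 𝟙 := K :+ (y :- 𝟙 :- 𝟙)) refl y K))) ⟩
      (y + K) * (y + K - 1#) * qₖ * F₂ ∎

  -- Evaluation of the closed form.

  -- The bracket A_n + B_n, with d and e the reciprocals of D and E.
  bracket : ∀ {D E N y d e i₁ i₂ s₁ s₂ h₁ h₂} → E ≈ D + N * y → D * d ≈ 1# → E * e ≈ 1# →
    D ^ 2 * E * i₁ ≈ 1# → D * E * i₂ ≈ 1# → s₁ ≈ h₁ → s₂ ≈ h₂ →
    (s₁ + (d - e)) ^ 2 + (s₂ + (d ^ 2 - e ^ 2)) ≈
    (h₂ + fromℕ 2 * N * y * i₁) + h₁ * (h₁ + fromℕ 2 * N * y * i₂)
  bracket {D} {E} {N} {y} {d} {e} {i₁} {i₂} {s₁} {s₂} {h₁} {h₂} E≈ Dd≈1 Ee≈1 inv₁ inv₂ s₁≈h₁ s₂≈h₂ = begin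
    (s₁ + (d - e)) ^ 2 + (s₂ + (d ^ 2 - e ^ 2))
      ≈⟨ +-cong (^-congˡ 2 (+-congʳ s₁≈h₁)) (+-congʳ s₂≈h₂) ⟩
    (h₁ + (d - e)) ^ 2 + (h₂ + (d ^ 2 - e ^ 2))
      -- The terms free of `h₁` and `h₂` combine to `2 d (d - e)`, and `d - e` is `N y d e` because
      -- `E - D = N y`.
      ≈⟨ solve 4 (λ h₁ h₂ d e → (h₁ :+ (d :- e)) :^ 2 :+ (h₂ :+ (d :^ 2 :- e :^ 2))
           := (h₂ :+ (d :* (d :- e) :+ d :* (d :- e))) :+ h₁ :* (h₁ :+ ((d :- e) :+ (d :- e)))) refl h₁ h₂ d e ⟩
    (h₂ + (d * (d - e) + d * (d - e))) + h₁ * (h₁ + ((d - e) + (d - e)))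
      ≈⟨ +-cong (+-congˡ (+-cong (*-congˡ d-e) (*-congˡ d-e))) (*-congˡ (+-congˡ (+-cong d-e d-e))) ⟩
    (h₂ + (d * (κ * (d * e)) + d * (κ * (d * e)))) + h₁ * (h₁ + (κ * (d * e) + κ * (d * e)))
      ≈⟨ solve 6 (λ h₁ h₂ d e N y → let κ = N :* y ; 2κ = (𝟙 :+ (𝟙 :+ 𝟘)) :* N :* y in
           (h₂ :+ (d :* (κ :* (d :* e)) :+ d :* (κ :* (d :* e)))) :+ h₁ :* (h₁ :+ (κ :* (d :* e) :+ κ :* (d :* e)))
           := (h₂ :+ 2κ :* (d :* d :* e)) :+ h₁ :* (h₁ :+ 2κ :* (d :* e))) refl h₁ h₂ d e N y ⟩
    (h₂ + fromℕ 2 * N * y * (d * d * e)) + h₁ * (h₁ + fromℕ 2 * N * y * (d * e))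
      ≈⟨ +-cong (+-congˡ (*-congˡ (inverse-unique dde inv₁)))
           (*-congˡ (+-congˡ (*-congˡ (inverse-unique de inv₂)))) ⟩
    (h₂ + fromℕ 2 * N * y * i₁) + h₁ * (h₁ + fromℕ 2 * N * y * i₂) ∎
    where
    κ = N * y
    de : D * E * (d * e) ≈ 1#
    de = begin
      D * E * (d * e)    ≈⟨ solve 4 (λ D E d e → D :* E :* (d :* e) := D :* d :* (E :* e)) refl D E d e ⟩
      D * d * (E * e)    ≈⟨ *-cong Dd≈1 Ee≈1 ⟩
      1# * 1#            ≈⟨ *-identityˡ 1# ⟩
      1#                 ∎
    dde : D ^ 2 * E * (d * d * e) ≈ 1#
    dde = begin
      D ^ 2 * E * (d * d * e)    ≈⟨ solve 4 (λ D E d e → D :^ 2 :* E :* (d :* d :* e)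
                                      := D :* d :* (D :* E :* (d :* e))) refl D E d e ⟩
      D * d * (D * E * (d * e))  ≈⟨ *-cong Dd≈1 de ⟩
      1# * 1#                    ≈⟨ *-identityˡ 1# ⟩
      1#                         ∎
    d-e : d - e ≈ κ * (d * e)
    d-e = begin
      d - e
        ≈⟨ solve 2 (λ d e → d :- e := 𝟙 :* d :- 𝟙 :* e) refl d e ⟩
      1# * d - 1# * e
        ≈⟨ +-cong (*-congʳ (sym Ee≈1)) (-‿cong (*-congʳ (sym Dd≈1))) ⟩
      E * e * d - D * d * e
        ≈⟨ +-congʳ (*-congʳ (*-congʳ E≈)) ⟩
      (D + κ) * e * d - D * d * e
        ≈⟨ solve 4 (λ D κ d e → (D :+ κ) :* e :* d :- D :* d :* e := κ :* (d :* e)) refl D κ d e ⟩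
      κ * (d * e) ∎

  -- With n = m + 1, E = (1 + x - y) + n y and z = x + 1: the left-hand side after summation by parts.
  residue-sum : ∀ m {x y e r u} → let z = x + 1# ; M = fromℕ m ; n = suc m in
    (∀ i → i ℕ.< n → (x + fromℕ (suc i)) * r i ≈ 1#) →
    (∀ i → i ℕ.< n → (x - y + fromℕ (suc i)) * u i ≈ 1#) →
    (1# + x - y + fromℕ n * y) * e ≈ 1# →
    (1# + 1#) * Δ m (λ i → (- (M * y) + fromℕ i) * falling (fromℕ i + (y - 1#)) m * r i ^ 3) ≈
    (- (M * y) - z) * (falling (y - 1# - z) m * residue r m) *
      (((∑< n r - ∑< n u) + (u 0 - e)) ^ 2
        + ((∑< n (λ i → r i ^ 2) - ∑< n (λ i → u i ^ 2)) + (u 0 ^ 2 - e ^ 2)))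
  residue-sum m {x} {y} {e} {r} {u} xr≈1 xyu≈1 Ee≈1 =
    -- At the pole `i = - z` the factor `- (M * y) + i` equals `- E`, and the factors of the falling
    -- factorial equal `- (x - y + t + 2)` for `t < m`. This explains the reciprocals `- e` and
    -- `- u (suc t)`.
    trans (third-linear* zr≈1 (- (M * y)) {w = - e} Ee≈1′
            (falling-moments zr≈1 (y - 1#) (λ t → - u (suc t)) m ℕ.≤-refl βw≈1))
      (*-congˡ (+-cong (*-cong s≈ (*-congʳ s≈)) t≈))
    where
    z = x + 1#
    M = fromℕ m
    zr≈1 : Reciprocals m z r
    zr≈1 i i≤m = trans (*-congʳ (+-assoc x 1# _)) (xr≈1 i (s≤s i≤m))
    Ee≈1′ : (- (M * y) - z) * - e ≈ 1#
    Ee≈1′ = trans (solve 4 (λ M x y e → (:- (M :* y) :- (x :+ 𝟙)) :* (:- e)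
      := (𝟙 :+ x :- y :+ (𝟙 :+ M) :* y) :* e) refl M x y e) Ee≈1
    βw≈1 : ∀ t → t ℕ.< m → (y - 1# - fromℕ t - z) * - u (suc t) ≈ 1#
    βw≈1 t t<m = trans (solve 4 (λ x y t u → (y :- 𝟙 :- t :- (x :+ 𝟙)) :* (:- u)
      := (x :- y :+ (𝟙 :+ (𝟙 :+ t))) :* u) refl x y (fromℕ t) (u (suc t))) (xyu≈1 (suc t) (s≤s t<m))
    -- The factors supply only `u 1` to `u m`. The missing `u 0`, the reciprocal of `1 + x - y`, is
    -- added and subtracted to complete the harmonic number of `x - y`.
    s≈ : ∑< (suc m) r + ∑< m (λ t → - u (suc t)) + - e ≈ (∑< (suc m) r - ∑< (suc m) u) + (u 0 - e)
    s≈ = begin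
      ∑< (suc m) r + ∑< m (λ t → - u (suc t)) + - e
        ≈⟨ +-congʳ (+-congˡ (∑<-neg m (λ t → u (suc t)))) ⟩
      ∑< (suc m) r + - ∑< m (λ t → u (suc t)) + - e
        ≈⟨ solve 4 (λ a b c e → a :+ :- b :+ :- e := (a :- (c :+ b)) :+ (c :- e)) refl _ _ (u 0) _ ⟩
      (∑< (suc m) r - (u 0 + ∑< m (λ t → u (suc t)))) + (u 0 - e)
        ≈⟨ +-congʳ (+-congˡ (-‿cong (∑<-suc m u))) ⟨
      (∑< (suc m) r - ∑< (suc m) u) + (u 0 - e) ∎
    r² = ∑< (suc m) (λ i → r i ^ 2)
    t≈ : r² - ∑< m (λ t → (- u (suc t)) ^ 2) - (- e) ^ 2 ≈
      (r² - ∑< (suc m) (λ i → u i ^ 2)) + (u 0 ^ 2 - e ^ 2)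
    t≈ = begin
      r² - ∑< m (λ t → (- u (suc t)) ^ 2) - (- e) ^ 2
        ≈⟨ +-congʳ (+-congˡ (-‿cong (∑<-cong m λ t _ → solve 1 (λ a → (:- a) :^ 2 := a :^ 2) refl (u (suc t))))) ⟩
      r² - ∑< m (λ t → u (suc t) ^ 2) - (- e) ^ 2
        ≈⟨ solve 4 (λ a b c e → a :- b :- (:- e) :^ 2 := (a :- (c :+ b)) :+ (c :- e :^ 2)) refl _ _ (u 0 ^ 2) e ⟩
      (r² - (u 0 ^ 2 + ∑< m (λ t → u (suc t) ^ 2))) + (u 0 ^ 2 - e ^ 2)
        ≈⟨ +-congʳ (+-congˡ (-‿cong (∑<-suc m (λ i → u i ^ 2)))) ⟨
      (r² - ∑< (suc m) (λ i → u i ^ 2)) + (u 0 ^ 2 - e ^ 2) ∎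

  -- The linear factor is `- E`, and the falling factorial is the product of `- (x - y + j)` for `j`
  -- from 2 to `n`. The factor `D` supplies `j = 1`, and the `n` signs are collected in front.
  signed-product : ∀ m x y → let n = suc m ; D = 1# + x - y in
    D * ((- (fromℕ m * y) - (x + 1#)) * falling (y - 1# - (x + 1#)) m) ≈
    (- 1#) ^ n * (D + fromℕ n * y) * falling (x - y + fromℕ n) n
  signed-product m x y = begin
    D * ((- (fromℕ m * y) - (x + 1#)) * falling (y - 1# - (x + 1#)) m)
      ≈⟨ *-congˡ (*-congˡ (falling-cong m
           (solve 2 (λ x y → y :- 𝟙 :- (x :+ 𝟙) := :- (x :- y) :- 𝟙 :- 𝟙) refl x y))) ⟩
    D * ((- (fromℕ m * y) - (x + 1#)) * Q)
      ≈⟨ solve 4 (λ m x y Q → (𝟙 :+ x :- y) :* ((:- (m :* y) :- (x :+ 𝟙)) :* Q)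
           := 𝟙 :* (𝟙 :+ x :- y :+ (𝟙 :+ m) :* y) :* ((:- (x :- y) :- 𝟙) :* Q)) refl (fromℕ m) x y Q ⟩
    1# * E * ((- (x - y) - 1#) * Q)
      ≈⟨ *-congʳ (*-congʳ (sign-square (suc m))) ⟨
    σ * σ * E * ((- (x - y) - 1#) * Q)
      ≈⟨ solve 3 (λ σ E f → σ :* σ :* E :* f := σ :* E :* (σ :* f)) refl σ E _ ⟩
    σ * E * (σ * ((- (x - y) - 1#) * Q))
      ≈⟨ *-congˡ (*-congˡ (falling-suc (- (x - y) - 1#) m)) ⟨
    σ * E * (σ * falling (- (x - y) - 1#) (suc m))
      ≈⟨ *-congˡ (falling-reflect (x - y) (suc m)) ⟨
    σ * E * falling (x - y + fromℕ (suc m)) (suc m) ∎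
    where
    D = 1# + x - y
    E = D + fromℕ (suc m) * y
    σ = (- 1#) ^ suc m
    Q = falling (- (x - y) - 1# - 1#) m

  -- Multiplying both sides by 2 (n - 1) fy, where fx, fy are n! times the binomial coefficients
  -- in the denominator of the right-hand side, clears all denominators but those in G and T.
  clear-denominators : ∀ {L M N D S β Q G T fx fy fz j mf i₁ i₂} →
    N ≈ 1# + M → fromℕ 2 * N * (N - 1#) * D * i₁ ≈ 1# → (fx * j) * (fy * j) * i₂ ≈ 1# →
    N * mf * j ≈ 1# → G * fx ≈ mf → D * (β * Q) ≈ S * fz →
    L * ((1# + 1#) * M * fy) ≈ β * (Q * G) * T →
    L ≈ (S * i₁) * ((fz * j) * i₂) * T
  clear-denominators {L} {M} {N} {D} {S} {β} {Q} {G} {T} {fx} {fy} {fz} {j} {mf} {i₁} {i₂}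
    N≈ inv₁ inv₂ invⱼ Gfx Sfz main = *-cancelʳ invertible (begin
      L * ((1# + 1#) * M * fy)
        ≈⟨ main ⟩
      β * (Q * G) * T
        ≈⟨ *-congʳ (*-congˡ (*-congˡ G≈)) ⟩
      β * (Q * ((1# + 1#) * M * D * i₁ * (fy * j * i₂))) * T
        ≈⟨ solve 9 (λ β Q M D i₁ fy j i₂ T → β :* (Q :* ((𝟙 :+ 𝟙) :* M :* D :* i₁ :* (fy :* j :* i₂))) :* T
             := D :* (β :* Q) :* (i₁ :* (j :* i₂) :* T :* ((𝟙 :+ 𝟙) :* M :* fy))) refl β Q M D i₁ fy j i₂ T ⟩
      D * (β * Q) * (i₁ * (j * i₂) * T * ((1# + 1#) * M * fy))
        ≈⟨ *-congʳ Sfz ⟩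
      S * fz * (i₁ * (j * i₂) * T * ((1# + 1#) * M * fy))
        ≈⟨ solve 7 (λ S fz i₁ j i₂ T K → S :* fz :* (i₁ :* (j :* i₂) :* T :* K)
             := (S :* i₁) :* ((fz :* j) :* i₂) :* T :* K) refl S fz i₁ j i₂ T ((1# + 1#) * M * fy) ⟩
      (S * i₁) * ((fz * j) * i₂) * T * ((1# + 1#) * M * fy) ∎)
    where
    inv₁′ : (1# + 1#) * N * M * D * i₁ ≈ 1#
    inv₁′ = begin
      (1# + 1#) * N * M * D * i₁
        ≈⟨ solve 4 (λ N M D i₁ → (𝟙 :+ 𝟙) :* N :* M :* D :* i₁
             := (𝟙 :+ (𝟙 :+ 𝟘)) :* N :* (𝟙 :+ M :- 𝟙) :* D :* i₁) refl N M D i₁ ⟩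
      fromℕ 2 * N * (1# + M - 1#) * D * i₁
        ≈⟨ *-congʳ (*-congʳ (*-congˡ (+-congʳ N≈))) ⟨
      fromℕ 2 * N * (N - 1#) * D * i₁
        ≈⟨ inv₁ ⟩
      1# ∎
    -- The cancelled factor divides the product of the two denominators inverted by `i₁` and `i₂`;
    -- its inverse consists of the remaining factors.
    invertible : (1# + 1#) * M * fy * (N * D * i₁ * (j * (fx * j) * i₂)) ≈ 1#
    invertible = begin
      (1# + 1#) * M * fy * (N * D * i₁ * (j * (fx * j) * i₂))
        ≈⟨ solve 8 (λ M fy N D i₁ j fx i₂ → (𝟙 :+ 𝟙) :* M :* fy :* (N :* D :* i₁ :* (j :* (fx :* j) :* i₂))
             := (𝟙 :+ 𝟙) :* N :* M :* D :* i₁ :* ((fx :* j) :* (fy :* j) :* i₂)) refl M fy N D i₁ j fx i₂ ⟩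
      (1# + 1#) * N * M * D * i₁ * ((fx * j) * (fy * j) * i₂)
        ≈⟨ *-cong inv₁′ inv₂ ⟩
      1# * 1#
        ≈⟨ *-identityˡ 1# ⟩
      1# ∎
    mfj : mf * j ≈ (1# + 1#) * M * D * i₁
    mfj = begin
      mf * j
        ≈⟨ *-identityˡ _ ⟨
      1# * (mf * j)
        ≈⟨ *-congʳ inv₁′ ⟨
      (1# + 1#) * N * M * D * i₁ * (mf * j)
        ≈⟨ solve 6 (λ N M D i₁ mf j → (𝟙 :+ 𝟙) :* N :* M :* D :* i₁ :* (mf :* j)
             := N :* mf :* j :* ((𝟙 :+ 𝟙) :* M :* D :* i₁)) refl N M D i₁ mf j ⟩
      N * mf * j * ((1# + 1#) * M * D * i₁)
        ≈⟨ trans (*-congʳ invⱼ) (*-identityˡ _) ⟩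
      (1# + 1#) * M * D * i₁ ∎
    G≈ : G ≈ (1# + 1#) * M * D * i₁ * (fy * j * i₂)
    G≈ = begin
      G
        ≈⟨ *-identityʳ G ⟨
      G * 1#
        ≈⟨ *-congˡ inv₂ ⟨
      G * ((fx * j) * (fy * j) * i₂)
        ≈⟨ solve 5 (λ G fx j fy i₂ → G :* ((fx :* j) :* (fy :* j) :* i₂)
             := G :* fx :* j :* (fy :* j :* i₂)) refl G fx j fy i₂ ⟩
      G * fx * j * (fy * j * i₂)
        ≈⟨ *-congʳ (trans (*-congʳ Gfx) mfj) ⟩
      (1# + 1#) * M * D * i₁ * (fy * j * i₂) ∎

  -- From the sum of the theorem to its closed form.

  weighted-term : ∀ {n y k i₁ i₂ f g} → 2 ℕ.≤ n → k ℕ.≤ n →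
    binom (y - fromℕ n + fromℕ k) k * i₁ ≈ 1# →
    (y + fromℕ k - 1#) * (y + fromℕ k) * i₂ ≈ 1# →
    f ≈ g →
    (- 1#) ^ k * binom (fromℕ n) k * (binom (y + fromℕ k) k * i₁) * ((y - 1#) * y * i₂) * f
      * falling (y - 1# - 1#) (n ℕ.∸ 2) ≈
    signed-binom n k * (falling (fromℕ k + (y - 1# - 1#)) (n ℕ.∸ 2) * g)
  weighted-term {n} {y} {k} {i₁} {i₂} {f} {g} 2≤n k≤n inv₁ inv₂ f≈g = trans
    (solve 5 (λ s a b h q → s :* a :* b :* h :* q := s :* (a :* b :* q :* h)) refl
      (signed-binom n k) (binom (y + fromℕ k) k * i₁) ((y - 1#) * y * i₂) f (falling (y - 1# - 1#) (n ℕ.∸ 2)))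
    (*-congˡ (*-cong (weight 2≤n k≤n inv₁ inv₂) f≈g))

  sum-weighted : ∀ n (t : ∀ k → k ℕ.≤ n → Carrier) {q₀ : Carrier} {f : ℕ → Carrier} →
    (∀ k k≤n → t k k≤n * q₀ ≈ signed-binom n k * f k) → sum-upTo n t * q₀ ≈ Δ n f
  sum-weighted n t {q₀} {f} t*q₀≈ = trans (sum-upTo-*ʳ n t q₀)
    (trans (sum-upTo≈∑< n {λ k k≤n → t k k≤n * q₀} (λ k → signed-binom n k * f k) t*q₀≈)
      (∑<-signed-binom n f))

  -- The splitting of `falling y n` into `y (y - 1) q₀` serves twice: `q₀` clears the coefficients
  -- of the sum and `y (y - 1)` is the factor in `falling-gosper`. The factor 2 belongs to the third
  -- moment.
  cleared-sum : ∀ l {x y L e r u} → let m = suc l ; n = suc m ; M = fromℕ m ; z = x + 1# in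
    (∀ i → i ℕ.< n → (x + fromℕ (suc i)) * r i ≈ 1#) →
    (∀ i → i ℕ.< n → (x - y + fromℕ (suc i)) * u i ≈ 1#) →
    (1# + x - y + fromℕ n * y) * e ≈ 1# →
    L * falling (y - 1# - 1#) l ≈
      Δ n (λ k → falling (fromℕ k + (y - 1# - 1#)) l * ∑< k (λ i → r i ^ 3)) →
    L * ((1# + 1#) * M * falling y n) ≈
    (- (M * y) - z) * (falling (y - 1# - z) m * residue r m) *
      (((∑< n r - ∑< n u) + (u 0 - e)) ^ 2
        + ((∑< n (λ i → r i ^ 2) - ∑< n (λ i → u i ^ 2)) + (u 0 ^ 2 - e ^ 2)))
  cleared-sum l {x} {y} {L} {e} {r} {u} xr≈1 xyu≈1 Ee≈1 L*q₀ = begin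
    L * ((1# + 1#) * M * falling y n)
      ≈⟨ *-congˡ (*-congˡ (trans (falling-suc y m) (*-congˡ (falling-suc (y - 1#) l)))) ⟩
    L * ((1# + 1#) * M * (y * ((y - 1#) * q₀)))
      ≈⟨ solve 4 (λ L M y q → L :* ((𝟙 :+ 𝟙) :* M :* (y :* ((y :- 𝟙) :* q)))
           := (𝟙 :+ 𝟙) :* (M :* (y :* (y :- 𝟙)) :* (L :* q))) refl L M y q₀ ⟩
    (1# + 1#) * (M * (y * (y - 1#)) * (L * q₀))
      ≈⟨ *-congˡ (*-congˡ L*q₀) ⟩
    (1# + 1#) * (M * (y * (y - 1#)) * Δ n (λ k → falling (fromℕ k + (y - 1# - 1#)) l * h₃ k))
      ≈⟨ *-congˡ (falling-gosper l y h₃) ⟩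
    (1# + 1#) * Δ m (λ i → (- (M * y) + fromℕ i) * falling (fromℕ i + (y - 1#)) m * (h₃ (suc i) - h₃ i))
      ≈⟨ *-congˡ (Δ-cong m λ i _ → *-congˡ
           (solve 2 (λ a b → a :+ b :- a := b) refl (h₃ i) (r i ^ 3))) ⟩
    (1# + 1#) * Δ m (λ i → (- (M * y) + fromℕ i) * falling (fromℕ i + (y - 1#)) m * r i ^ 3)
      ≈⟨ residue-sum m xr≈1 xyu≈1 Ee≈1 ⟩
    _ ∎
    where
    m = suc l
    n = suc m
    M = fromℕ m
    q₀ = falling (y - 1# - 1#) l
    h₃ : ℕ → Carrier
    h₃ k = ∑< k (λ i → r i ^ 3)

  ∑<recip≈H₁ : ∀ {n u} (h : NoPole u n) → ∑< n (recip h) ≈ H 1 n u h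
  ∑<recip≈H₁ {n} h = trans (∑<-cong n λ i _ → sym (*-identityʳ _)) (sym (H≈∑<recip 1 h h ℕ.≤-refl))

  ∑<recip²≈H₂ : ∀ {n u} (h : NoPole u n) → ∑< n (λ i → recip h i ^ 2) ≈ H 2 n u h
  ∑<recip²≈H₂ h = sym (H≈∑<recip 2 h h ℕ.≤-refl)

  H₁-difference : ∀ {n u v} (hu : NoPole u n) (hv : NoPole v n) →
    ∑< n (recip hu) - ∑< n (recip hv) ≈ H 1 n u hu - H 1 n v hv
  H₁-difference hu hv = +-cong (∑<recip≈H₁ hu) (-‿cong (∑<recip≈H₁ hv))

  H₂-difference : ∀ {n u v} (hu : NoPole u n) (hv : NoPole v n) →
    ∑< n (λ i → recip hu i ^ 2) - ∑< n (λ i → recip hv i ^ 2) ≈ H 2 n u hu - H 2 n v hv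
  H₂-difference hu hv = +-cong (∑<recip²≈H₂ hu) (-‿cong (∑<recip²≈H₂ hv))

  -- All divisions enter through elements characterised by their products, which keeps the algebra
  -- independent of particular proofs of apartness.
  closed-form : ∀ {n x y L e i₁ i₂ i₃ i₄ r u h₁ h₂} → 2 ℕ.≤ n →
    let D = 1# + x - y ; E = D + fromℕ n * y in
    (∀ i → i ℕ.< n → (x + fromℕ (suc i)) * r i ≈ 1#) →
    (∀ i → i ℕ.< n → (x - y + fromℕ (suc i)) * u i ≈ 1#) →
    E * e ≈ 1# →
    fromℕ 2 * fromℕ n * (fromℕ n - 1#) * D * i₁ ≈ 1# →
    binom (x + fromℕ n) n * binom y n * i₂ ≈ 1# →
    D ^ 2 * E * i₃ ≈ 1# →
    D * E * i₄ ≈ 1# →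
    ∑< n r - ∑< n u ≈ h₁ →
    ∑< n (λ i → r i ^ 2) - ∑< n (λ i → u i ^ 2) ≈ h₂ →
    L * falling (y - 1# - 1#) (n ℕ.∸ 2) ≈
      Δ n (λ k → falling (fromℕ k + (y - 1# - 1#)) (n ℕ.∸ 2) * ∑< k (λ i → r i ^ 3)) →
    L ≈ ((- 1#) ^ n * E * i₁) * (binom (x - y + fromℕ n) n * i₂)
      * ((h₂ + fromℕ 2 * fromℕ n * y * i₃) + h₁ * (h₁ + fromℕ 2 * fromℕ n * y * i₄))
  closed-form {n@(suc m@(suc l))} {x} {y} {L} {e} {r = r} {u = u} (s≤s (s≤s z≤n))
    xr≈1 xyu≈1 Ee≈1 inv₁ inv₂ inv₃ inv₄ h₁≈ h₂≈ L*q₀ = trans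
    (clear-denominators refl inv₁ inv₂
      (trans (*-congʳ (sym (×1-homo-* n (m ℕ.!)))) (fact-inverse n))
      (trans (*-congˡ (falling-cong n (sym (+-assoc x 1# _)))) (residue*falling m zr≈1))
      (signed-product m x y)
      (cleared-sum l xr≈1 xyu≈1 Ee≈1 L*q₀))
    (*-congˡ (bracket refl Du≈1 Ee≈1 inv₃ inv₄ h₁≈ h₂≈))
    where
    zr≈1 : Reciprocals m (x + 1#) r
    zr≈1 i i≤m = trans (*-congʳ (+-assoc x 1# _)) (xr≈1 i (s≤s i≤m))
    -- The entry `u 0` plays the role of `d` in `bracket`.
    Du≈1 : (1# + x - y) * u 0 ≈ 1#
    Du≈1 = trans (*-congʳ (solve 2 (λ x y → 𝟙 :+ x :- y := x :- y :+ (𝟙 :+ 𝟘)) refl x y))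
      (xyu≈1 0 (s≤s z≤n))

  -- Conversion of the apartness proofs in the theorem blows up unless they agree syntactically, which
  -- is achieved by making them indices, to be solved by unification.
  data ApartnessProofs {n x y u}
    (hu : NoPole u n)
    (h  : ∀ k → k ℕ.≤ n → NoPole x k)
    (p₁ : ∀ k → k ℕ.≤ n → binom (y - fromℕ n + fromℕ k) k # 0#)
    (p₂ : ∀ k → k ℕ.≤ n → (y + fromℕ k - 1#) * (y + fromℕ k) # 0#)
    (d₁ : fromℕ 2 * fromℕ n * (fromℕ n - 1#) * (1# + x - y) # 0#)
    (d₂ : binom (x + fromℕ n) n * binom y n # 0#)
    (d₃ : (1# + x - y) ^ 2 * (1# + x - y + fromℕ n * y) # 0#)
    (d₄ : (1# + x - y) * (1# + x - y + fromℕ n * y) # 0#) : Set where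
    proofs : ApartnessProofs hu h p₁ p₂ d₁ d₂ d₃ d₄

  harmonic-identity :
    ∀ {n x y u hu h p₁ p₂ d₁ d₂ d₃ d₄} → ApartnessProofs {n} {x} {y} {u} hu h p₁ p₂ d₁ d₂ d₃ d₄ →
    2 ℕ.≤ n → (hx : NoPole x n) → u ≈ x - y → (hd : 1# + x - y + fromℕ n * y # 0#) →
    let D = 1# + x - y
        E = 1# + x - y + fromℕ n * y
        A = (H 2 n x hx - H 2 n u hu)
              + (fromℕ 2 * fromℕ n * y) / D ^ 2 * E ⟨ d₃ ⟩
        B = (H 1 n x hx - H 1 n u hu)
              * (H 1 n x hx - H 1 n u hu
                  + (fromℕ 2 * fromℕ n * y) / D * E ⟨ d₄ ⟩)
    in
    sum-upTo n (λ k k≤n →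
      (- 1#) ^ k
        * binom (fromℕ n) k
        * (binom (y + fromℕ k) k / binom (y - fromℕ n + fromℕ k) k ⟨ p₁ k k≤n ⟩)
        * (((y - 1#) * y) / (y + fromℕ k - 1#) * (y + fromℕ k) ⟨ p₂ k k≤n ⟩)
        * H 3 k x (h k k≤n))
    ≈
    (((- 1#) ^ n * E) / fromℕ 2 * fromℕ n * (fromℕ n - 1#) * D ⟨ d₁ ⟩)
      * (binom (x - y + fromℕ n) n / binom (x + fromℕ n) n * binom y n ⟨ d₂ ⟩)
      * (A + B)
  harmonic-identity {n} {x} {y} {u} {hu} {h} {p₁} {p₂} {d₁} {d₂} {d₃} {d₄} proofs 2≤n hx u≈x-y hd =
    closed-form 2≤n (recip-inverse hx)
      (λ i i<n → trans (*-congʳ (+-congʳ (sym u≈x-y))) (recip-inverse hu i i<n)) (inverse hd)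
      (inverse d₁) (inverse d₂) (inverse d₃) (inverse d₄)
      (H₁-difference hx hu) (H₂-difference hx hu)
      (sum-weighted n
        (λ k k≤n → (- 1#) ^ k
          * binom (fromℕ n) k
          * (binom (y + fromℕ k) k / binom (y - fromℕ n + fromℕ k) k ⟨ p₁ k k≤n ⟩)
          * (((y - 1#) * y) / (y + fromℕ k - 1#) * (y + fromℕ k) ⟨ p₂ k k≤n ⟩)
          * H 3 k x (h k k≤n))
        (λ k k≤n → weighted-term 2≤n k≤n (inverse (p₁ k k≤n)) (inverse (p₂ k k≤n))
          (H≈∑<recip 3 hx (h k k≤n) k≤n)))

-- Specialisation to the complex numbers.

open import Defs
open HarmonicSums Complexes.ℂ-heytingField Complexes.ℂ-char0
  using (ApartnessProofs; proofs; harmonic-identity)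

-- Fixes, as indices, exactly the apartness proofs that occur in the theorem.
theorem18-proofs : (n : ℕ) (2≤n : 2 ≤ n) (x y : ℂ)
    (hx : ∀ j → 1 ≤ j → j ≤ n → x # - fromℕ j)
    (hxy : ∀ j → 1 ≤ j → j ≤ n → x - y # - fromℕ j)
    (hd : 1# + x - y + fromℕ n * y # 0#)
    (hy : ∀ i → ℤ.- (+ n) ℤ.≤ i → i ℤ.< + n → y # fromℤ i) →
    let D#0 = 1+x-y#0 2≤n hxy in
    ApartnessProofs {n} {x} {y} {x - y} hxy (λ k k≤n → NoPole-≤ k≤n hx) (λ k k≤n → binom[y-n+k,k]#0 hy k≤n)
      (λ k k≤n → [y+k-1][y+k]#0 hy 2≤n k≤n)
      (*#0 (2n[n-1]#0 2≤n) D#0)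
      (*#0 (binom[x+n,n]#0 hx) (binom[y,n]#0 hy))
      (*#0 (x^n#0 2 D#0) hd)
      (*#0 D#0 hd)
theorem18-proofs n 2≤n x y hx hxy hd hy = proofs

theorem18 :
    (n : ℕ) (2≤n : 2 ≤ n) (x y : ℂ)
    (hx : ∀ j → 1 ≤ j → j ≤ n → x # - fromℕ j)
    (hxy : ∀ j → 1 ≤ j → j ≤ n → x - y # - fromℕ j)
    (hd : 1# + x - y + fromℕ n * y # 0#)
    (hy : ∀ i → ℤ.- (+ n) ℤ.≤ i → i ℤ.< + n → y # fromℤ i) →
    let D = 1# + x - y
        E = 1# + x - y + fromℕ n * y
        D#0 = 1+x-y#0 2≤n hxy
        A = (H 2 n x hx - H 2 n (x - y) hxy)
              + (fromℕ 2 * fromℕ n * y) / D ^ 2 * E ⟨ *#0 (x^n#0 2 D#0) hd ⟩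
        B = (H 1 n x hx - H 1 n (x - y) hxy)
              * (H 1 n x hx - H 1 n (x - y) hxy
                  + (fromℕ 2 * fromℕ n * y) / D * E ⟨ *#0 D#0 hd ⟩)
    in
    sum-upTo n (λ k k≤n →
      (- 1#) ^ k
        * binom (fromℕ n) k
        * (binom (y + fromℕ k) k / binom (y - fromℕ n + fromℕ k) k ⟨ binom[y-n+k,k]#0 hy k≤n ⟩)
        * (((y - 1#) * y) / (y + fromℕ k - 1#) * (y + fromℕ k) ⟨ [y+k-1][y+k]#0 hy 2≤n k≤n ⟩)
        * H 3 k x (NoPole-≤ k≤n hx))
    ≈
    (((- 1#) ^ n * E) / fromℕ 2 * fromℕ n * (fromℕ n - 1#) * D ⟨ *#0 (2n[n-1]#0 2≤n) D#0 ⟩)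
      * (binom (x - y + fromℕ n) n / binom (x + fromℕ n) n * binom y n
          ⟨ *#0 (binom[x+n,n]#0 hx) (binom[y,n]#0 hy) ⟩)
      * (A + B)
theorem18 n 2≤n x y hx hxy hd hy =
  harmonic-identity (theorem18-proofs n 2≤n x y hx hxy hd hy) 2≤n hx
    (HeytingField.refl Complexes.ℂ-heytingField) hd
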